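{- Let $d\ge 1$ and let $\mathcal{L}_{\leq d}$ be the set of all lonesum $0$-$1$ matrices (of any size, including the empty $0\times 0$ matrix) with no all-zero row and no all-zero column, in which at most $d$ columns are of the same type and at most $d$ rows are of the same type. For a matrix $M$ let $r(M)$ and $c(M)$ be its numbers of rows and columns, and define the formal power series \[ L_{\leq d}(x,y)=\sum_{M\in\mathcal{L}_{\leq d}}\frac{x^{r(M)}}{r(M)!}\frac{y^{c(M)}}{c(M)!}. \] Then \[ L_{\leq d}(x,y)=\frac{1}{E_d(x)+E_d(y)-E_d(x)E_d(y)},\qquad\text{where } E_d(z)=\sum_{i=0}^{d}\frac{z^i}{i!}. \]
   Context: A $0$-$1$ matrix is lonesum if it is uniquely determined by its row sum vector and column sum vector; equivalently, it contains no $2\times 2$ submatrix equal to $\begin{pmatrix}1&0\\0&1\end{pmatrix}$ or $\begin{pmatrix}0&1\\1&0\end{pmatrix}$. Two rows (resp. columns) are of the same type iff they are identical vectors. -}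

module Defs where

open import Data.Bool.Base using (if_then_else_)
open import Data.Fin.Base using (Fin; zero; toℕ)
open import Data.Fin.Properties using () renaming (_≟_ to _≟ᶠ_)
open import Data.Integer.Base using (+_)
open import Data.List.Base using (List; []; _∷_; length; filter; allFin; cartesianProductWith)
open import Data.List.Membership.Propositional using (_∈_)
open import Data.List.Membership.Propositional.Properties using (∈-allFin; ∈-cartesianProductWith⁺)
open import Data.List.Relation.Unary.Any using (here)
import Data.List.Relation.Unary.All as ListAll
open import Data.List.Relation.Unary.AllPairs using ([]; _∷_)
open import Data.List.Relation.Unary.Unique.Propositional using (Unique)
open import Data.List.Relation.Unary.Unique.Propositional.Properties using (allFin⁺; cartesianProductWith⁺)
open import Data.Nat.Base as ℕ using (ℕ; zero; suc; _∸_; _≤_; _≤ᵇ_; _!)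
open import Data.Nat.Properties using (_!≢0; _≤?_) renaming (_≟_ to _≟ⁿ_)
open import Data.Product.Base using (_×_)
open import Data.Rational.Base using (ℚ; 0ℚ; 1ℚ; _+_; _-_; _*_; _/_)
open import Data.Rational.Properties using (+-0-commutativeMonoid)
open import Data.Vec.Base using (Vec; []; _∷_; map; sum; count; replicate; transpose)
open import Data.Vec.Properties using (≡-dec; ∷-injective)
open import Data.Vec.Relation.Unary.All using (All; all?)
open import Relation.Binary.Definitions using (DecidableEquality)
open import Relation.Binary.PropositionalEquality using (_≡_; _≢_; refl)
open import Relation.Nullary.Decidable using (Dec; ¬?; map′; _×-dec_; _→-dec_)

import Algebra.Properties.CommutativeMonoid.Sum +-0-commutativeMonoid as ℚSum

Matrix : ℕ → ℕ → Set
Matrix m n = Vec (Vec (Fin 2) n) m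

private
  variable
    m n : ℕ

_≟ᵛ_ : DecidableEquality (Vec (Fin 2) n)
_≟ᵛ_ = ≡-dec _≟ᶠ_

_≟ᴹ_ : DecidableEquality (Matrix m n)
_≟ᴹ_ = ≡-dec _≟ᵛ_

rowSums : Matrix m n → Vec ℕ m
rowSums = map (λ r → sum (map toℕ r))

colSums : Matrix m n → Vec ℕ n
colSums M = rowSums (transpose M)

Lonesum : Matrix m n → Set
Lonesum {m} {n} M =
  (N : Matrix m n) → rowSums N ≡ rowSums M → colSums N ≡ colSums M → N ≡ M

-- The zero vector of length 0 is all-zero, so an m × 0 matrix with m > 0 does
-- have an all-zero row (and dually); only the 0 × 0 empty matrix has neither.
NoZeroRow : Matrix m n → Set
NoZeroRow {n = n} M = All (λ r → r ≢ replicate n zero) M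

NoZeroCol : Matrix m n → Set
NoZeroCol M = NoZeroRow (transpose M)

AtMostSameRows : ℕ → Matrix m n → Set
AtMostSameRows d M = All (λ r → count (r ≟ᵛ_) M ≤ d) M

AtMostSameCols : ℕ → Matrix m n → Set
AtMostSameCols d M = AtMostSameRows d (transpose M)

InL : ℕ → Matrix m n → Set
InL d M =
  Lonesum M × NoZeroRow M × NoZeroCol M × AtMostSameCols d M × AtMostSameRows d M

allVecs : {A : Set} → List A → (n : ℕ) → List (Vec A n)
allVecs xs zero    = [] ∷ []
allVecs xs (suc n) = cartesianProductWith _∷_ xs (allVecs xs n)

allMatrices : (m n : ℕ) → List (Matrix m n)
allMatrices m n = allVecs (allVecs (allFin 2) n) m

∈-allVecs : {A : Set} {xs : List A} → (∀ a → a ∈ xs) → (v : Vec A n) → v ∈ allVecs xs n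
∈-allVecs complete []      = here refl
∈-allVecs complete (a ∷ v) =
  ∈-cartesianProductWith⁺ _∷_ (complete a) (∈-allVecs complete v)

allVecs-unique : {A : Set} {xs : List A} → Unique xs → ∀ n → Unique (allVecs xs n)
allVecs-unique xs! zero    = ListAll.[] ∷ []
allVecs-unique xs! (suc n) =
  cartesianProductWith⁺ _∷_ ∷-injective xs! (allVecs-unique xs! n)

∈-allMatrices : (M : Matrix m n) → M ∈ allMatrices m n
∈-allMatrices = ∈-allVecs (∈-allVecs ∈-allFin)

allMatrices-unique : ∀ m n → Unique (allMatrices m n)
allMatrices-unique m n = allVecs-unique (allVecs-unique (allFin⁺ 2) n) m

lonesum? : (M : Matrix m n) → Dec (Lonesum M)
lonesum? {m} {n} M =
  map′ (λ p N → ListAll.lookup p (∈-allMatrices N)) (λ p → ListAll.tabulate (λ {N} _ → p N))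
    (ListAll.all?
      (λ N → ≡-dec _≟ⁿ_ (rowSums N) (rowSums M) →-dec
             (≡-dec _≟ⁿ_ (colSums N) (colSums M) →-dec (N ≟ᴹ M)))
      (allMatrices m n))

noZeroRow? : (M : Matrix m n) → Dec (NoZeroRow M)
noZeroRow? M = all? (λ r → ¬? (r ≟ᵛ replicate _ zero)) M

atMostSameRows? : ∀ d (M : Matrix m n) → Dec (AtMostSameRows d M)
atMostSameRows? d M = all? (λ r → count (r ≟ᵛ_) M ≤? d) M

inL? : ∀ d (M : Matrix m n) → Dec (InL d M)
inL? d M =
  lonesum? M ×-dec noZeroRow? M ×-dec noZeroRow? (transpose M) ×-dec
  atMostSameRows? d (transpose M) ×-dec atMostSameRows? d M

countL : ℕ → ℕ → ℕ → ℕ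
countL d m n = length (filter (inL? d) (allMatrices m n))

-- ℚ[[x,y]]: f i j is the coefficient of xⁱ yʲ.
Series : Set
Series = ℕ → ℕ → ℚ

infix  4 _≋_
infixl 6 _⊕_ _⊖_
infixl 7 _⊗_

_≋_ : Series → Series → Set
f ≋ g = ∀ i j → f i j ≡ g i j

𝟏 : Series
𝟏 zero zero = 1ℚ
𝟏 _    _    = 0ℚ

_⊕_ _⊖_ _⊗_ : Series → Series → Series
(f ⊕ g) i j = f i j + g i j
(f ⊖ g) i j = f i j - g i j
(f ⊗ g) i j =
  ℚSum.sum {suc i} λ a → ℚSum.sum {suc j} λ b →
    f (toℕ a) (toℕ b) * g (i ∸ toℕ a) (j ∸ toℕ b)

-- f ≋1/ g says f = 1/g: the inverse of g in the commutative ring ℚ[[x,y]] is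
-- unique, and is characterised by f g = 1.
infix 4 _≋1/_
_≋1/_ : Series → Series → Set
f ≋1/ g = f ⊗ g ≋ 𝟏

inX inY : (ℕ → ℚ) → Series
inX f i zero    = f i
inX f i (suc j) = 0ℚ
inY f zero    j = f j
inY f (suc i) j = 0ℚ

1/!_ : ℕ → ℚ
1/! n = (+ 1 / n !) {{n !≢0}}

E : ℕ → ℕ → ℚ
E d i = if i ≤ᵇ d then 1/! i else 0ℚ

-- Grouping the sum over all matrices by size, the m × n ones contribute
-- countL d m n equal terms xᵐ/m! yⁿ/n!.
L : ℕ → Series
L d m n = (+ countL d m n / 1) * (1/! m * 1/! n)

{-# OPTIONS --safe #-}

-- Since E(x) + E(y) − E(x)E(y) = 1 − (E(x) − 1)(E(y) − 1), the claim is the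
-- recurrence
--   L = 1 + (E(x) − 1)(E(y) − 1) L.
-- The rows of a lonesum matrix form a chain under inclusion (two incomparable
-- rows could exchange a pair of entries), so without zero columns a nonempty M
-- has a full row.  Let A be its set of full rows and B the set of columns that
-- vanish outside A; B is nonempty by the same argument applied to M with A
-- deleted.  Deleting A and B leaves a smaller matrix of the same kind, and
-- (A, B, remainder) determines M.  Here A is one class of equal rows and B one
-- class of equal columns, so their sizes range over 1, …, d.

module Submission where

open import Defs
open import Data.Bool.Base using (Bool; true; false; if_then_else_)
open import Data.Fin.Base as Fin using (Fin; toℕ)
open import Data.Fin.Patterns using (0F; 1F)
import Data.Fin.Properties as Fin
open import Data.Integer.Base as ℤ using ()
import Data.Integer.Properties as ℤ
open import Data.List.Base as List using (List; []; _∷_; _++_; length; filter; allFin; concatMap)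
open import Data.List.Membership.Propositional using (_∈_; find; lose)
open import Data.List.Membership.Propositional.Properties using (∈-allFin; ∈-filter⁺; ∈-filter⁻; ∈-map⁺; ∈-map⁻; ∈-concatMap⁺; ∈-concatMap⁻)
open import Data.List.Membership.Propositional.Properties.WithK using (unique∧set⇒bag)
open import Data.List.Properties using (length-map; length-++)
open import Data.List.Relation.Binary.BagAndSetEquality using (∼bag⇒↭)
open import Data.List.Relation.Binary.Disjoint.Propositional using (Disjoint)
open import Data.List.Relation.Binary.Permutation.Propositional.Properties using (↭-length)
import Data.List.Relation.Unary.All as ListAll
import Data.List.Relation.Unary.All.Properties as ListAll
import Data.List.Relation.Unary.AllPairs as AllPairs
import Data.List.Relation.Unary.AllPairs.Properties as AllPairs
open import Data.List.Relation.Unary.Unique.Propositional using (Unique)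
import Data.List.Relation.Unary.Unique.Propositional.Properties as Unique
open import Data.Nat.Base as ℕ using (ℕ; zero; suc; _∸_; _≤_; z≤n; s≤s; _≤ᵇ_; _!; NonZero)
import Data.Nat.Properties as ℕ
open import Data.Product.Base using (∃; ∃₂; _×_; _,_; proj₁; proj₂)
open import Data.Rational.Base using (ℚ; 0ℚ; 1ℚ; _+_; _-_; _*_; _/_; fromℚᵘ)
open import Data.Rational.Properties using (+-0-commutativeMonoid; +-assoc; +-identityˡ; +-identityʳ; +-inverseʳ; *-assoc; *-comm; *-identityˡ; *-identityʳ; *-zeroˡ; *-zeroʳ; *-distribˡ-+; *-distribʳ-+; fromℚᵘ-cong; toℚᵘ-fromℚᵘ; toℚᵘ-homo-+; toℚᵘ-homo-*; toℚᵘ-injective)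
open import Data.Rational.Solver using (module +-*-Solver)
open import Data.Rational.Unnormalised.Base as ℚᵘ using (mkℚᵘ; *≡*)
import Data.Rational.Unnormalised.Properties as ℚᵘ
open import Data.Sum.Base using (_⊎_; inj₁; inj₂)
open import Data.Vec.Base using (Vec; []; _∷_; map; sum; count; replicate; transpose; zipWith; _⊛_)
open import Data.Vec.Properties using (∷-injective; ∷-injectiveˡ; ∷-injectiveʳ; map-∘; map-cong; map-replicate)
open import Data.Vec.Relation.Binary.Pointwise.Inductive as Pointwise using (Pointwise; []; _∷_)
open import Data.Vec.Relation.Unary.All as All using (All; []; _∷_)
import Data.Vec.Relation.Unary.All.Properties as All
open import Function.Base using (_∘_)
open import Function.Bundles using (mk⇔)
open import Relation.Binary.Definitions using (DecidableEquality)
open import Relation.Binary.PropositionalEquality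
open import Relation.Nullary using (¬_; Dec; yes; no; does; contradiction)
open import Relation.Nullary.Decidable using (_×-dec_)
open import Relation.Unary using (Decidable)
open +-*-Solver using (solve; con; _:+_; _:*_; _:-_; _:=_)
open ≡-Reasoning

import Algebra.Properties.CommutativeMonoid.Sum +-0-commutativeMonoid as ℚSum

-- A line that is all 0 or all 1 is forced by its sum. This is why inserting or deleting zero
-- columns and full rows respects the definition of `Lonesum` by sums. Deletion is handled through
-- its inverse. A subset is a 0-1 vector `A`, and `ext A v w` puts `v` at the 1s of `A` and the
-- entries of `w` at its 0s; indexing `w` by `zeros A` gives remainders the right size without
-- casts. Rows and columns do not play symmetric roles: the inserted rows are full, whereas a column
-- of B, once the rows of A are back, is the vector `A` itself. Hence A has to be recovered first,
-- as the set of full rows, and B after it, as the set of columns equal to `A`. Nonemptiness of B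
-- keeps the other rows from being full; nonemptiness of A keeps the columns of B from being zero.
-- The factorials turn the choice of subsets into products: m!/(a! b!) subsets of size b leave a
-- rows, so division by m! n! makes the sum over all pairs (A, B) a Cauchy product in x and y, with
-- a factor 1/b! for 1 ≤ b ≤ d in each variable. The 1 in the recurrence is the empty matrix, which
-- has no full row to delete.

private
  variable
    m n d : ℕ
    X Y : Set

-- Subsets as 0-1 vectors, and insertion of a repeated entry.

weight : Vec (Fin 2) n → ℕ
weight r = sum (map toℕ r)

zeros : Vec (Fin 2) n → ℕ
zeros []       = 0
zeros (0F ∷ A) = suc (zeros A)
zeros (1F ∷ A) = zeros A

ext : (A : Vec (Fin 2) m) → X → Vec X (zeros A) → Vec X m
ext []       v []      = []
ext (0F ∷ A) v (x ∷ w) = x ∷ ext A v w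
ext (1F ∷ A) v w       = v ∷ ext A v w

0s 1s : Vec (Fin 2) n
0s = replicate _ 0F
1s = replicate _ 1F

map-injective : {f : X → Y} → (∀ {x y} → f x ≡ f y → x ≡ y) →
                {xs ys : Vec X n} → map f xs ≡ map f ys → xs ≡ ys
map-injective inj {[]}     {[]}     eq = refl
map-injective inj {x ∷ xs} {y ∷ ys} eq =
  cong₂ _∷_ (inj (∷-injectiveˡ eq)) (map-injective inj (∷-injectiveʳ eq))

map-ext : (f : X → Y) (A : Vec (Fin 2) m) {v : X} (w : Vec X (zeros A)) →
          map f (ext A v w) ≡ ext A (f v) (map f w)
map-ext f []       []      = refl
map-ext f (0F ∷ A) (x ∷ w) = cong (f x ∷_) (map-ext f A w)
map-ext f (1F ∷ A) w       = cong (_ ∷_) (map-ext f A w)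

ext-injective : (A : Vec (Fin 2) m) {v : X} {w w′ : Vec X (zeros A)} →
                ext A v w ≡ ext A v w′ → w ≡ w′
ext-injective []       {w = []}    {[]}     eq = refl
ext-injective (0F ∷ A) {w = _ ∷ _} {_ ∷ _} eq with refl , eq′ ← ∷-injective eq =
  cong (_ ∷_) (ext-injective A eq′)
ext-injective (1F ∷ A) eq = ext-injective A (∷-injectiveʳ eq)

ext-replicate : (A : Vec (Fin 2) m) {v : X} → ext A v (replicate _ v) ≡ replicate m v
ext-replicate []       = refl
ext-replicate (0F ∷ A) = cong (_ ∷_) (ext-replicate A)
ext-replicate (1F ∷ A) = cong (_ ∷_) (ext-replicate A)

ext-1F-0s : (A : Vec (Fin 2) m) → ext A 1F 0s ≡ A
ext-1F-0s []       = refl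
ext-1F-0s (0F ∷ A) = cong (_ ∷_) (ext-1F-0s A)
ext-1F-0s (1F ∷ A) = cong (_ ∷_) (ext-1F-0s A)

-- Letting `A` mark every occurrence of `v` makes the splitting canonical; `ext-unique` is the
-- uniqueness half.
ext-split : DecidableEquality X → (v : X) (xs : Vec X m) →
            ∃ λ A → ∃ λ w → xs ≡ ext A v w × All (_≢ v) w
ext-split _≟_ v []       = [] , [] , refl , []
ext-split _≟_ v (x ∷ xs) with x ≟ v | ext-split _≟_ v xs
... | yes refl | A , w , refl , w≢v = 1F ∷ A , w , refl , w≢v
... | no x≢v   | A , w , refl , w≢v = 0F ∷ A , x ∷ w , refl , x≢v ∷ w≢v

ext-unique : (A A′ : Vec (Fin 2) m) {v : X} {w : Vec X (zeros A)} {w′ : Vec X (zeros A′)} →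
             All (_≢ v) w → All (_≢ v) w′ → ext A v w ≡ ext A′ v w′ → A ≡ A′
ext-unique []       []       _ _ eq = refl
ext-unique (0F ∷ A) (0F ∷ A′) (_ ∷ p) (_ ∷ p′) eq = cong (0F ∷_) (ext-unique A A′ p p′ (∷-injectiveʳ eq))
ext-unique (0F ∷ A) (1F ∷ A′) (x≢v ∷ _) _ eq = contradiction (proj₁ (∷-injective eq)) x≢v
ext-unique (1F ∷ A) (0F ∷ A′) _ (x≢v ∷ _) eq = contradiction (sym (proj₁ (∷-injective eq))) x≢v
ext-unique (1F ∷ A) (1F ∷ A′) p p′ eq = cong (1F ∷_) (ext-unique A A′ p p′ (∷-injectiveʳ eq))

-- Entries with image `f v` can only be `v`. With `f` the weight, this recovers the zero or full
-- lines of a matrix from its vector of sums.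
ext-lift : (f : X → Y) {v : X} → (∀ {x} → f x ≡ f v → x ≡ v) →
           (A : Vec (Fin 2) m) (xs : Vec X m) {w : Vec Y (zeros A)} →
           map f xs ≡ ext A (f v) w → ∃ λ ys → xs ≡ ext A v ys × map f ys ≡ w
ext-lift f inj []      []       {[]} eq = [] , refl , refl
ext-lift f inj (0F ∷ A) (x ∷ xs) {y ∷ w} eq with refl , eq′ ← ∷-injective eq
  with ys , refl , refl ← ext-lift f inj A xs eq′ = x ∷ ys , refl , refl
ext-lift f inj (1F ∷ A) (x ∷ xs) eq with fx , eq′ ← ∷-injective eq
  with refl ← inj fx | ys , refl , refl ← ext-lift f inj A xs eq′ = ys , refl , refl

module _ {P : X → Set} where

  -- The condition on `v` is guarded because an empty `A` inserts no copy of it; a refutation of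
  -- `1 ≤ weight A` discharges the guard.
  All-ext⁺ : (A : Vec (Fin 2) m) {v : X} {w : Vec X (zeros A)} →
             (1 ≤ weight A → P v) → All P w → All P (ext A v w)
  All-ext⁺ []       pv []       = []
  All-ext⁺ (0F ∷ A) pv (p ∷ ps) = p ∷ All-ext⁺ A pv ps
  All-ext⁺ (1F ∷ A) pv ps       = pv (s≤s z≤n) ∷ All-ext⁺ A (λ _ → pv (s≤s z≤n)) ps

  All-ext⁻ : (A : Vec (Fin 2) m) {v : X} {w : Vec X (zeros A)} → All P (ext A v w) → All P w
  All-ext⁻ []       {w = []}    []       = []
  All-ext⁻ (0F ∷ A) {w = _ ∷ _} (p ∷ ps) = p ∷ All-ext⁻ A ps
  All-ext⁻ (1F ∷ A)             (_ ∷ ps) = All-ext⁻ A ps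

  All-ext-filler : (A : Vec (Fin 2) m) {v : X} {w : Vec X (zeros A)} →
                   1 ≤ weight A → All P (ext A v w) → P v
  All-ext-filler (0F ∷ A) {w = _ ∷ _} 1≤A (_ ∷ ps) = All-ext-filler A 1≤A ps
  All-ext-filler (1F ∷ A) _ (p ∷ _) = p

weight-ext-0F : (B : Vec (Fin 2) n) (r : Vec (Fin 2) (zeros B)) → weight (ext B 0F r) ≡ weight r
weight-ext-0F []       []      = refl
weight-ext-0F (0F ∷ B) (x ∷ r) = cong (toℕ x ℕ.+_) (weight-ext-0F B r)
weight-ext-0F (1F ∷ B) r       = weight-ext-0F B r

weight-ext-1F : (A : Vec (Fin 2) n) (c : Vec (Fin 2) (zeros A)) →
               weight (ext A 1F c) ≡ weight A ℕ.+ weight c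
weight-ext-1F []       []      = refl
weight-ext-1F (0F ∷ A) (0F ∷ c) = weight-ext-1F A c
weight-ext-1F (0F ∷ A) (1F ∷ c) = trans (cong suc (weight-ext-1F A c)) (sym (ℕ.+-suc (weight A) (weight c)))
weight-ext-1F (1F ∷ A) c       = cong suc (weight-ext-1F A c)

weight-0s : ∀ n → weight (0s {n}) ≡ 0
weight-0s zero    = refl
weight-0s (suc n) = weight-0s n

weight-1s : ∀ n → weight (1s {n}) ≡ n
weight-1s zero    = refl
weight-1s (suc n) = cong suc (weight-1s n)

weight≤n : (r : Vec (Fin 2) n) → weight r ≤ n
weight≤n []       = z≤n
weight≤n (0F ∷ r) = ℕ.m≤n⇒m≤1+n (weight≤n r)
weight≤n (1F ∷ r) = s≤s (weight≤n r)

weight≡0⇒0s : {r : Vec (Fin 2) n} → weight r ≡ 0 → r ≡ 0s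
weight≡0⇒0s {r = []}    _  = refl
weight≡0⇒0s {r = 0F ∷ r} eq = cong (0F ∷_) (weight≡0⇒0s eq)

weight≡n⇒1s : {r : Vec (Fin 2) n} → weight r ≡ n → r ≡ 1s
weight≡n⇒1s {r = []}    _  = refl
weight≡n⇒1s {r = 0F ∷ r} eq = contradiction (subst (_≤ _) eq (weight≤n r)) ℕ.1+n≰n
weight≡n⇒1s {r = 1F ∷ r} eq = cong (1F ∷_) (weight≡n⇒1s (ℕ.suc-injective eq))

-- Transposition, and how it acts on inserted lines.

transpose-∷ : (r : Vec X n) (M : Vec (Vec X n) m) →
              transpose (r ∷ M) ≡ zipWith _∷_ r (transpose M)
transpose-∷ r M = go r (transpose M)
  where
  go : ∀ {n k} (r : Vec X n) (T : Vec (Vec X k) n) → ((replicate n (Vec._∷_ {n = k}) ⊛ r) ⊛ T) ≡ zipWith Vec._∷_ r T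
  go []      []      = refl
  go (x ∷ r) (c ∷ T) = cong (_ ∷_) (go r T)

transpose-zipWith-∷ : (r : Vec X n) (T : Vec (Vec X m) n) →
                      transpose (zipWith _∷_ r T) ≡ r ∷ transpose T
transpose-zipWith-∷ []      []      = refl
transpose-zipWith-∷ (x ∷ r) (c ∷ T) = begin
  transpose ((x ∷ c) ∷ zipWith _∷_ r T)           ≡⟨ transpose-∷ (x ∷ c) (zipWith _∷_ r T) ⟩
  zipWith _∷_ (x ∷ c) (transpose (zipWith _∷_ r T)) ≡⟨ cong (zipWith _∷_ (x ∷ c)) (transpose-zipWith-∷ r T) ⟩
  (x ∷ r) ∷ zipWith _∷_ c (transpose T)            ≡⟨ cong (_ ∷_) (transpose-∷ c T) ⟨
  (x ∷ r) ∷ transpose (c ∷ T)                      ∎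

transpose-involutive : (M : Vec (Vec X n) m) → transpose (transpose M) ≡ M
transpose-involutive []      = empty _
  where
  empty : (v : Vec Y 0) → v ≡ []
  empty [] = refl
transpose-involutive (r ∷ M) = begin
  transpose (transpose (r ∷ M))               ≡⟨ cong transpose (transpose-∷ r M) ⟩
  transpose (zipWith _∷_ r (transpose M))     ≡⟨ transpose-zipWith-∷ r (transpose M) ⟩
  r ∷ transpose (transpose M)                 ≡⟨ cong (r ∷_) (transpose-involutive M) ⟩
  r ∷ M                                       ∎

transpose-injective : {M N : Vec (Vec X n) m} → transpose M ≡ transpose N → M ≡ N
transpose-injective {M = M} {N} eq =
  trans (sym (transpose-involutive M)) (trans (cong transpose eq) (transpose-involutive N))

transpose-map-ext : (B : Vec (Fin 2) n) (M : Matrix m (zeros B)) →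
                    transpose (map (ext B 0F) M) ≡ ext B 0s (transpose M)
transpose-map-ext B []      = sym (ext-replicate B)
transpose-map-ext B (r ∷ M) = begin
  transpose (map (ext B 0F) (r ∷ M))                      ≡⟨ transpose-∷ (ext B 0F r) (map (ext B 0F) M) ⟩
  zipWith _∷_ (ext B 0F r) (transpose (map (ext B 0F) M)) ≡⟨ cong (zipWith _∷_ (ext B 0F r)) (transpose-map-ext B M) ⟩
  zipWith _∷_ (ext B 0F r) (ext B 0s (transpose M))      ≡⟨ go B r (transpose M) ⟩
  ext B 0s (zipWith _∷_ r (transpose M))                ≡⟨ cong (ext B 0s) (transpose-∷ r M) ⟨
  ext B 0s (transpose (r ∷ M))                          ∎
  where
  go : ∀ {n k} (B : Vec (Fin 2) n) (r : Vec (Fin 2) (zeros B)) (T : Matrix (zeros B) k) →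
       zipWith _∷_ (ext B 0F r) (ext B 0s T) ≡ ext B 0s (zipWith _∷_ r T)
  go []       []      []      = refl
  go (0F ∷ B) (x ∷ r) (c ∷ T) = cong (_ ∷_) (go B r T)
  go (1F ∷ B) r       T       = cong (_ ∷_) (go B r T)

transpose≡ext⇒≡map-ext : (B : Vec (Fin 2) n) {N : Matrix m n} {T : Matrix (zeros B) m} →
                         transpose N ≡ ext B 0s T → N ≡ map (ext B 0F) (transpose T)
transpose≡ext⇒≡map-ext B {N} {T} eq = transpose-injective (begin
  transpose N                              ≡⟨ eq ⟩
  ext B 0s T                               ≡⟨ cong (ext B 0s) (transpose-involutive T) ⟨
  ext B 0s (transpose (transpose T))       ≡⟨ transpose-map-ext B (transpose T) ⟨
  transpose (map (ext B 0F) (transpose T))  ∎)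

transpose-ext-1s : (A : Vec (Fin 2) m) (N : Matrix (zeros A) n) →
                   transpose (ext A 1s N) ≡ map (ext A 1F) (transpose N)
transpose-ext-1s {n = n} [] [] = sym (map-replicate (ext [] 1F) [] n)
transpose-ext-1s (0F ∷ A) (r ∷ N) = begin
  transpose (r ∷ ext A 1s N)                      ≡⟨ transpose-∷ r (ext A 1s N) ⟩
  zipWith _∷_ r (transpose (ext A 1s N))          ≡⟨ cong (zipWith _∷_ r) (transpose-ext-1s A N) ⟩
  zipWith _∷_ r (map (ext A 1F) (transpose N))     ≡⟨ go r (transpose N) ⟩
  map (ext (0F ∷ A) 1F) (zipWith _∷_ r (transpose N)) ≡⟨ cong (map (ext (0F ∷ A) 1F)) (transpose-∷ r N) ⟨
  map (ext (0F ∷ A) 1F) (transpose (r ∷ N))         ∎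
  where
  go : ∀ {n} (r : Vec (Fin 2) n) (T : Matrix n (zeros A)) →
       zipWith _∷_ r (map (ext A 1F) T) ≡ map (ext (0F ∷ A) 1F) (zipWith _∷_ r T)
  go []      []      = refl
  go (x ∷ r) (c ∷ T) = cong (_ ∷_) (go r T)
transpose-ext-1s (1F ∷ A) N = begin
  transpose (1s ∷ ext A 1s N)                  ≡⟨ transpose-∷ 1s (ext A 1s N) ⟩
  zipWith _∷_ 1s (transpose (ext A 1s N))      ≡⟨ cong (zipWith _∷_ 1s) (transpose-ext-1s A N) ⟩
  zipWith _∷_ 1s (map (ext A 1F) (transpose N)) ≡⟨ go (transpose N) ⟩
  map (ext (1F ∷ A) 1F) (transpose N)            ∎
  where
  go : ∀ {n} (T : Matrix n (zeros A)) →
       zipWith _∷_ 1s (map (ext A 1F) T) ≡ map (ext (1F ∷ A) 1F) T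
  go []      = refl
  go (c ∷ T) = cong (_ ∷_) (go T)

-- Lonesum matrices under insertion and deletion of zero columns and full rows.

rowSums-map-ext : (B : Vec (Fin 2) n) (M : Matrix m (zeros B)) →
                  rowSums (map (ext B 0F) M) ≡ rowSums M
rowSums-map-ext B M = trans (sym (map-∘ weight (ext B 0F) M)) (map-cong (weight-ext-0F B) M)

colSums-map-ext : (B : Vec (Fin 2) n) (M : Matrix m (zeros B)) →
                  colSums (map (ext B 0F) M) ≡ ext B (weight (0s {m})) (colSums M)
colSums-map-ext B M = trans (cong rowSums (transpose-map-ext B M)) (map-ext weight B (transpose M))

rowSums-ext-1s : (A : Vec (Fin 2) m) (N : Matrix (zeros A) n) →
                 rowSums (ext A 1s N) ≡ ext A (weight (1s {n})) (rowSums N)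
rowSums-ext-1s A N = map-ext weight A N

colSums-ext-1s : (A : Vec (Fin 2) m) (N : Matrix (zeros A) n) →
                 colSums (ext A 1s N) ≡ map (weight A ℕ.+_) (colSums N)
colSums-ext-1s A N = begin
  colSums (ext A 1s N)                      ≡⟨ cong rowSums (transpose-ext-1s A N) ⟩
  map weight (map (ext A 1F) (transpose N))  ≡⟨ map-∘ weight (ext A 1F) (transpose N) ⟨
  map (weight ∘ ext A 1F) (transpose N)      ≡⟨ map-cong (weight-ext-1F A) (transpose N) ⟩
  map ((weight A ℕ.+_) ∘ weight) (transpose N) ≡⟨ map-∘ (weight A ℕ.+_) weight (transpose N) ⟩
  map (weight A ℕ.+_) (colSums N)             ∎

map-ext-injective : (B : Vec (Fin 2) n) {M N : Matrix m (zeros B)} →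
                    map (ext B 0F) M ≡ map (ext B 0F) N → M ≡ N
map-ext-injective B = map-injective (ext-injective B)

-- A competitor `N` has column sum 0 at every column of `B`, so these columns vanish and `N` is
-- itself an extension by zero columns; its remainder competes with `M`.
lonesum-map-ext⁺ : (B : Vec (Fin 2) n) (M : Matrix m (zeros B)) → Lonesum M → Lonesum (map (ext B 0F) M)
lonesum-map-ext⁺ {m = m} B M lone N rows cols
  with T , eqT , colsT ← ext-lift weight (λ eq → weight≡0⇒0s (trans eq (weight-0s m))) B (transpose N)
                           (trans cols (colSums-map-ext B M))
  = begin
  N                            ≡⟨ N≡ ⟩
  map (ext B 0F) (transpose T)  ≡⟨ cong (map (ext B 0F)) (lone (transpose T) rows′ cols′) ⟩
  map (ext B 0F) M              ∎
  where
  N≡ : N ≡ map (ext B 0F) (transpose T)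
  N≡ = transpose≡ext⇒≡map-ext B eqT
  rows′ : rowSums (transpose T) ≡ rowSums M
  rows′ = begin
    rowSums (transpose T)                 ≡⟨ rowSums-map-ext B (transpose T) ⟨
    rowSums (map (ext B 0F) (transpose T)) ≡⟨ cong rowSums N≡ ⟨
    rowSums N                             ≡⟨ rows ⟩
    rowSums (map (ext B 0F) M)             ≡⟨ rowSums-map-ext B M ⟩
    rowSums M                             ∎
  cols′ : colSums (transpose T) ≡ colSums M
  cols′ = trans (cong rowSums (transpose-involutive T)) colsT

lonesum-map-ext⁻ : (B : Vec (Fin 2) n) (M : Matrix m (zeros B)) → Lonesum (map (ext B 0F) M) → Lonesum M
lonesum-map-ext⁻ {m = m} B M lone N rows cols = map-ext-injective B (lone (map (ext B 0F) N)
  (trans (rowSums-map-ext B N) (trans rows (sym (rowSums-map-ext B M))))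
  (trans (colSums-map-ext B N) (trans (cong (ext B (weight (0s {m}))) cols) (sym (colSums-map-ext B M)))))

-- A row whose sum is the number of columns is full, so a competitor keeps the rows of `A`. They add
-- the same `weight A` to each column sum, and this cancels.
lonesum-ext-1s⁺ : (A : Vec (Fin 2) m) (M : Matrix (zeros A) n) → Lonesum M → Lonesum (ext A 1s M)
lonesum-ext-1s⁺ {n = n} A M lone N rows cols
  with N′ , refl , rows′ ← ext-lift weight (λ eq → weight≡n⇒1s (trans eq (weight-1s n))) A N
                             (trans rows (rowSums-ext-1s A M))
  = cong (ext A 1s) (lone N′ rows′ (map-injective (ℕ.+-cancelˡ-≡ (weight A) _ _) (begin
  map (weight A ℕ.+_) (colSums N′)   ≡⟨ colSums-ext-1s A N′ ⟨
  colSums (ext A 1s N′)            ≡⟨ cols ⟩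
  colSums (ext A 1s M)             ≡⟨ colSums-ext-1s A M ⟩
  map (weight A ℕ.+_) (colSums M)    ∎)))

lonesum-ext-1s⁻ : (A : Vec (Fin 2) m) (M : Matrix (zeros A) n) → Lonesum (ext A 1s M) → Lonesum M
lonesum-ext-1s⁻ {n = n} A M lone N rows cols = ext-injective A (lone (ext A 1s N)
  (trans (rowSums-ext-1s A N) (trans (cong (ext A (weight (1s {n}))) rows) (sym (rowSums-ext-1s A M))))
  (trans (colSums-ext-1s A N) (trans (cong (map (weight A ℕ.+_)) cols) (sym (colSums-ext-1s A M)))))

-- The rows of a lonesum matrix form a chain with a full row at its top.

infix 4 _≼_
_≼_ : Vec (Fin 2) n → Vec (Fin 2) n → Set
_≼_ = Pointwise Fin._≤_

≼-refl : {r : Vec (Fin 2) n} → r ≼ r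
≼-refl = Pointwise.refl Fin.≤-refl

≼-trans : {r s t : Vec (Fin 2) n} → r ≼ s → s ≼ t → r ≼ t
≼-trans = Pointwise.trans Fin.≤-trans

Comparable : Vec (Fin 2) n → Vec (Fin 2) n → Set
Comparable r s = r ≼ s ⊎ s ≼ r

infixr 6 _⊞_
_⊞_ : Vec (Fin 2) n → Vec ℕ n → Vec ℕ n
_⊞_ = zipWith (λ b k → toℕ b ℕ.+ k)

colSums-∷ : (r : Vec (Fin 2) n) (M : Matrix m n) → colSums (r ∷ M) ≡ r ⊞ colSums M
colSums-∷ r M = trans (cong rowSums (transpose-∷ r M)) (go r (transpose M))
  where
  go : ∀ {n k} (r : Vec (Fin 2) n) (T : Matrix n k) → rowSums (zipWith _∷_ r T) ≡ r ⊞ rowSums T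
  go []      []      = refl
  go (x ∷ r) (c ∷ T) = cong (_ ∷_) (go r T)

colSums-∷∷ : (r s : Vec (Fin 2) n) (M : Matrix m n) → colSums (r ∷ s ∷ M) ≡ r ⊞ s ⊞ colSums M
colSums-∷∷ r s M = trans (colSums-∷ r (s ∷ M)) (cong (r ⊞_) (colSums-∷ s M))

⊞-swap : (r s : Vec (Fin 2) n) (c : Vec ℕ n) → r ⊞ s ⊞ c ≡ s ⊞ r ⊞ c
⊞-swap []      []      []      = refl
⊞-swap (x ∷ r) (y ∷ s) (k ∷ c) = cong₂ _∷_
  (trans (sym (ℕ.+-assoc (toℕ x) (toℕ y) k)) (trans (cong (ℕ._+ k) (ℕ.+-comm (toℕ x) (toℕ y))) (ℕ.+-assoc (toℕ y) (toℕ x) k)))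
  (⊞-swap r s c)

infix 4 _≈⊞_
-- Equality of the columnwise sums of two pairs of rows, stated with an arbitrary remainder `c` so
-- that it fits the right side of `colSums-∷∷` directly.
_≈⊞_ : (p q : Vec (Fin 2) n × Vec (Fin 2) n) → Set
_≈⊞_ {n} (r , s) (r′ , s′) = (c : Vec ℕ n) → r ⊞ s ⊞ c ≡ r′ ⊞ s′ ⊞ c

∷-≈⊞ : ∀ x y {r s r′ s′ : Vec (Fin 2) n} → (r , s) ≈⊞ (r′ , s′) → (x ∷ r , y ∷ s) ≈⊞ (x ∷ r′ , y ∷ s′)
∷-≈⊞ x y eq (k ∷ c) = cong (_ ∷_) (eq c)

-- Looks for a column where r is 0 and s is 1, and moves that 1 up from s to r.
transfer : (r s : Vec (Fin 2) n) →
  s ≼ r ⊎ ∃₂ λ r′ s′ → weight r′ ≡ suc (weight r) × suc (weight s′) ≡ weight s × (r′ , s′) ≈⊞ (r , s)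
transfer []       []      = inj₁ []
transfer (0F ∷ r) (1F ∷ s) = inj₂ (1F ∷ r , 0F ∷ s , refl , refl , λ { (_ ∷ _) → refl })
transfer (0F ∷ r) (0F ∷ s) with transfer r s
... | inj₁ s≼r = inj₁ (z≤n ∷ s≼r)
... | inj₂ (r′ , s′ , wr , ws , eq) = inj₂ (0F ∷ r′ , 0F ∷ s′ , wr , ws , ∷-≈⊞ 0F 0F eq)
transfer (1F ∷ r) (0F ∷ s) with transfer r s
... | inj₁ s≼r = inj₁ (z≤n ∷ s≼r)
... | inj₂ (r′ , s′ , wr , ws , eq) = inj₂ (1F ∷ r′ , 0F ∷ s′ , cong suc wr , ws , ∷-≈⊞ 1F 0F eq)
transfer (1F ∷ r) (1F ∷ s) with transfer r s
... | inj₁ s≼r = inj₁ (s≤s z≤n ∷ s≼r)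
... | inj₂ (r′ , s′ , wr , ws , eq) = inj₂ (1F ∷ r′ , 1F ∷ s′ , cong suc wr , cong suc ws , ∷-≈⊞ 1F 1F eq)

Exchange : (r s : Vec (Fin 2) n) → Set
Exchange r s = ∃₂ λ r′ s′ → r′ ≢ r × weight r′ ≡ weight r × weight s′ ≡ weight s × (r′ , s′) ≈⊞ (r , s)

-- At the first column where the rows differ, one of them has the 1. `transfer` either finds a later
-- column where the other row has it, and then flipping both columns preserves all sums, or shows
-- that the rows are comparable.
exchange : (r s : Vec (Fin 2) n) → Comparable r s ⊎ Exchange r s
exchange []       []      = inj₁ (inj₁ [])
exchange (0F ∷ r) (1F ∷ s) with transfer s r
... | inj₁ r≼s = inj₁ (inj₁ (z≤n ∷ r≼s))
-- The tails move a 1 from `r` to `s` and the heads move one back, so both weights are restored; the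
-- new first row differs from the old one in its head.
... | inj₂ (s′ , r′ , ws , wr , eq) = inj₂ (1F ∷ r′ , 0F ∷ s′ , (λ ()) , wr , ws ,
  λ { (_ ∷ c) → cong (_ ∷_) (trans (⊞-swap r′ s′ c) (trans (eq c) (⊞-swap s r c))) })
exchange (1F ∷ r) (0F ∷ s) with transfer r s
... | inj₁ s≼r = inj₁ (inj₂ (z≤n ∷ s≼r))
... | inj₂ (r′ , s′ , wr , ws , eq) = inj₂ (0F ∷ r′ , 1F ∷ s′ , (λ ()) , wr , ws ,
  λ { (_ ∷ c) → cong (_ ∷_) (eq c) })
exchange (0F ∷ r) (0F ∷ s) with exchange r s
... | inj₁ (inj₁ r≼s) = inj₁ (inj₁ (z≤n ∷ r≼s))
... | inj₁ (inj₂ s≼r) = inj₁ (inj₂ (z≤n ∷ s≼r))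
... | inj₂ (r′ , s′ , r′≢r , wr , ws , eq) =
  inj₂ (0F ∷ r′ , 0F ∷ s′ , r′≢r ∘ ∷-injectiveʳ , wr , ws , ∷-≈⊞ 0F 0F eq)
exchange (1F ∷ r) (1F ∷ s) with exchange r s
... | inj₁ (inj₁ r≼s) = inj₁ (inj₁ (s≤s z≤n ∷ r≼s))
... | inj₁ (inj₂ s≼r) = inj₁ (inj₂ (s≤s z≤n ∷ s≼r))
... | inj₂ (r′ , s′ , r′≢r , wr , ws , eq) =
  inj₂ (1F ∷ r′ , 1F ∷ s′ , r′≢r ∘ ∷-injectiveʳ , cong suc wr , cong suc ws , ∷-≈⊞ 1F 1F eq)

lonesum⇒comparable : (r s : Vec (Fin 2) n) (M : Matrix m n) → Lonesum (r ∷ s ∷ M) → Comparable r s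
lonesum⇒comparable r s M lone with exchange r s
... | inj₁ comparable = comparable
... | inj₂ (r′ , s′ , r′≢r , wr , ws , eq) = contradiction
  (∷-injectiveˡ (lone (r′ ∷ s′ ∷ M) (cong₂ (λ a b → a ∷ b ∷ rowSums M) wr ws)
    (trans (colSums-∷∷ r′ s′ M) (trans (eq (colSums M)) (sym (colSums-∷∷ r s M))))))
  r′≢r

lonesum-tail : (r : Vec (Fin 2) n) (M : Matrix m n) → Lonesum (r ∷ M) → Lonesum M
lonesum-tail r M lone N rows cols = ∷-injectiveʳ (lone (r ∷ N) (cong (_ ∷_) rows)
  (trans (colSums-∷ r N) (trans (cong (r ⊞_) cols) (sym (colSums-∷ r M)))))

-- Putting `s` back in second place turns a competitor of `r ∷ M` into one of `r ∷ s ∷ M`.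
lonesum-drop₂ : (r s : Vec (Fin 2) n) (M : Matrix m n) → Lonesum (r ∷ s ∷ M) → Lonesum (r ∷ M)
lonesum-drop₂ r s M lone (r′ ∷ N) rows cols
  with refl ← lone (r′ ∷ s ∷ N) (cong₂ (λ a b → a ∷ _ ∷ b) (∷-injectiveˡ rows) (∷-injectiveʳ rows)) (begin
    colSums (r′ ∷ s ∷ N)   ≡⟨ colSums-∷∷ r′ s N ⟩
    r′ ⊞ s ⊞ colSums N     ≡⟨ ⊞-swap r′ s (colSums N) ⟩
    s ⊞ r′ ⊞ colSums N     ≡⟨ cong (s ⊞_) (colSums-∷ r′ N) ⟨
    s ⊞ colSums (r′ ∷ N)   ≡⟨ cong (s ⊞_) cols ⟩
    s ⊞ colSums (r ∷ M)    ≡⟨ cong (s ⊞_) (colSums-∷ r M) ⟩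
    s ⊞ r ⊞ colSums M      ≡⟨ ⊞-swap s r (colSums M) ⟩
    r ⊞ s ⊞ colSums M      ≡⟨ colSums-∷∷ r s M ⟨
    colSums (r ∷ s ∷ M)    ∎)
  = refl

lonesum⇒All-comparable : (r : Vec (Fin 2) n) (M : Matrix m n) → Lonesum (r ∷ M) → All (Comparable r) M
lonesum⇒All-comparable r []      lone = []
lonesum⇒All-comparable r (s ∷ M) lone =
  lonesum⇒comparable r s M lone ∷ lonesum⇒All-comparable r M (lonesum-drop₂ r s M lone)

-- P is arbitrary so that the recursive call can carry comparability with the head row.
greatest-row : {P : Vec (Fin 2) n → Set} (r : Vec (Fin 2) n) (M : Matrix m n) →
               Lonesum (r ∷ M) → All P (r ∷ M) → ∃ λ t → P t × All (_≼ t) (r ∷ M)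
greatest-row r []      lone (pr ∷ []) = r , pr , ≼-refl ∷ []
greatest-row r (s ∷ M) lone (pr ∷ ps)
  with greatest-row s M (lonesum-tail r (s ∷ M) lone) (All.zip (ps , lonesum⇒All-comparable r (s ∷ M) lone))
... | t , (pt , inj₁ r≼t) , M≼t = t , pt , r≼t ∷ M≼t
... | t , (pt , inj₂ t≼r) , M≼t = r , pr , ≼-refl ∷ All.map (λ s≼t → ≼-trans s≼t t≼r) M≼t

upper-bound-zero : (t : Vec (Fin 2) n) (M : Matrix m n) → All (_≼ t) M →
                   Pointwise (λ b c → b ≡ 0F → c ≡ 0s) t (transpose M)
upper-bound-zero t []      []           = base t
  where
  base : ∀ {n} (t : Vec (Fin 2) n) → Pointwise (λ b c → b ≡ 0F → c ≡ []) t (replicate n [])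
  base []      = []
  base (_ ∷ t) = (λ _ → refl) ∷ base t
upper-bound-zero t (r ∷ M) (r≼t ∷ M≼t) rewrite transpose-∷ r M = go r≼t (upper-bound-zero t M M≼t)
  where
  go : ∀ {n k} {r t : Vec (Fin 2) n} {T : Matrix n k} → r ≼ t →
       Pointwise (λ b c → b ≡ 0F → c ≡ 0s) t T →
       Pointwise (λ b c → b ≡ 0F → c ≡ 0s) t (zipWith _∷_ r T)
  go [] [] = []
  go {r = 0F ∷ _} (z≤n ∷ r≼t) (f ∷ fs) = (cong (0F ∷_) ∘ f) ∷ go r≼t fs
  go {r = 1F ∷ _} {1F ∷ _} (_ ∷ r≼t) (f ∷ fs) = (λ ()) ∷ go r≼t fs

upper-bound-full : (t : Vec (Fin 2) n) (M : Matrix m n) → All (_≼ t) M → NoZeroCol M → t ≡ 1s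
upper-bound-full t M M≼t nzc = go (upper-bound-zero t M M≼t) nzc
  where
  go : ∀ {n k} {t : Vec (Fin 2) n} {T : Matrix n k} → Pointwise (λ b c → b ≡ 0F → c ≡ 0s) t T →
       NoZeroRow T → t ≡ 1s
  go [] [] = refl
  go {t = 0F ∷ t} (f ∷ fs) (nz ∷ nzs) = contradiction (f refl) nz
  go {t = 1F ∷ t} (f ∷ fs) (nz ∷ nzs) = cong (1F ∷_) (go fs nzs)

-- The greatest row must be full, since a column where it has 0 would be a zero column. Taking
-- `_≢ 1s` for `P` in `greatest-row` makes that very row carry the contradiction.
lonesum⇒full-row : (M : Matrix m (suc n)) → Lonesum M → NoZeroCol M → ¬ All (_≢ 1s) M
-- Without rows, each of the `suc n` columns is the empty vector and thus a zero column.
lonesum⇒full-row []      lone (nz ∷ _) _ = nz refl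
lonesum⇒full-row (r ∷ M) lone nzc notFull with greatest-row r M lone notFull
... | t , t≢1s , M≼t = t≢1s (upper-bound-full t (r ∷ M) M≼t nzc)

-- Sizes of the classes of equal lines.

ext≢replicate : (A : Vec (Fin 2) m) {u v : X} {w : Vec X (zeros A)} →
                v ≢ u → 1 ≤ weight A → ext A v w ≢ replicate m u
ext≢replicate (0F ∷ A) {w = _ ∷ _} v≢u 1≤A eq = ext≢replicate A v≢u 1≤A (∷-injectiveʳ eq)
ext≢replicate (1F ∷ A) v≢u _ eq = v≢u (∷-injectiveˡ eq)

module _ (_≟_ : DecidableEquality X) where

  count-ext-≢ : (A : Vec (Fin 2) m) {r v : X} (w : Vec X (zeros A)) → r ≢ v →
                count (r ≟_) (ext A v w) ≡ count (r ≟_) w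
  count-ext-≢ []       [] r≢v = refl
  count-ext-≢ (0F ∷ A) {r} (x ∷ w) r≢v with r ≟ x
  ... | yes _ = cong suc (count-ext-≢ A w r≢v)
  ... | no  _ = count-ext-≢ A w r≢v
  count-ext-≢ (1F ∷ A) {r} {v} w r≢v with r ≟ v
  ... | yes r≡v = contradiction r≡v r≢v
  ... | no  _   = count-ext-≢ A w r≢v

  count-ext-≡ : (A : Vec (Fin 2) m) {v : X} (w : Vec X (zeros A)) → All (_≢ v) w →
                count (v ≟_) (ext A v w) ≡ weight A
  count-ext-≡ []       [] _ = refl
  count-ext-≡ (0F ∷ A) {v} (x ∷ w) (x≢v ∷ w≢v) with v ≟ x
  ... | yes v≡x = contradiction (sym v≡x) x≢v
  ... | no  _   = count-ext-≡ A w w≢v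
  count-ext-≡ (1F ∷ A) {v} w w≢v with v ≟ v
  ... | yes _  = cong suc (count-ext-≡ A w w≢v)
  ... | no v≢v = contradiction refl v≢v

module _ (_≟ˣ_ : DecidableEquality X) (_≟ʸ_ : DecidableEquality Y)
         {f : X → Y} (f-injective : ∀ {x y} → f x ≡ f y → x ≡ y) where

  count-map : (x : X) (w : Vec X m) → count (f x ≟ʸ_) (map f w) ≡ count (x ≟ˣ_) w
  count-map x []      = refl
  count-map x (y ∷ w) with f x ≟ʸ f y | x ≟ˣ y
  ... | yes _     | yes _   = cong suc (count-map x w)
  ... | no _      | no _    = count-map x w
  ... | yes fx≡fy | no x≢y  = contradiction (f-injective fx≡fy) x≢y
  ... | no fx≢fy  | yes x≡y = contradiction (cong f x≡y) fx≢fy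

  module _ (A : Vec (Fin 2) m) {v : Y} {w : Vec X (zeros A)} (fw≢v : All (λ x → f x ≢ v) w) where

    private
      count-ext-map : ∀ {x} → f x ≢ v → count (f x ≟ʸ_) (ext A v (map f w)) ≡ count (x ≟ˣ_) w
      count-ext-map fx≢v = trans (count-ext-≢ _≟ʸ_ A (map f w) fx≢v) (count-map _ w)

      count-filler : count (v ≟ʸ_) (ext A v (map f w)) ≡ weight A
      count-filler = count-ext-≡ _≟ʸ_ A (map f w) (All.map⁺ fw≢v)

    -- Since `f` is injective and its values on `w` avoid `v`, the classes of equal entries in the
    -- extension are the images of the old classes and one further class, the fillers, of size
    -- `weight A`.
    multiplicity-ext⁺ : weight A ≤ d → All (λ x → count (x ≟ˣ_) w ≤ d) w →
                        All (λ y → count (y ≟ʸ_) (ext A v (map f w)) ≤ d) (ext A v (map f w))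
    multiplicity-ext⁺ A≤d ps = All-ext⁺ A (λ _ → ℕ.≤-trans (ℕ.≤-reflexive count-filler) A≤d)
      (All.map⁺ (All.map (λ (fx≢v , p) → ℕ.≤-trans (ℕ.≤-reflexive (count-ext-map fx≢v)) p) (All.zip (fw≢v , ps))))

    multiplicity-ext⁻ : All (λ y → count (y ≟ʸ_) (ext A v (map f w)) ≤ d) (ext A v (map f w)) →
                        All (λ x → count (x ≟ˣ_) w ≤ d) w
    multiplicity-ext⁻ ps = All.map (λ (fx≢v , p) → ℕ.≤-trans (ℕ.≤-reflexive (sym (count-ext-map fx≢v))) p)
      (All.zip (fw≢v , All.map⁻ (All-ext⁻ A ps)))

    multiplicity-ext-filler : 1 ≤ weight A →
                              All (λ y → count (y ≟ʸ_) (ext A v (map f w)) ≤ d) (ext A v (map f w)) →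
                              weight A ≤ d
    multiplicity-ext-filler 1≤A ps = ℕ.≤-trans (ℕ.≤-reflexive (sym count-filler)) (All-ext-filler A 1≤A ps)

-- The decomposition into A, B and remainder: existence and uniqueness.

-- Insert full rows at A; the remaining rows are 0 in the columns of B.
extM : (A : Vec (Fin 2) m) (B : Vec (Fin 2) n) → Matrix (zeros A) (zeros B) → Matrix m n
extM A B M = ext A 1s (map (ext B 0F) M)

extM-injective : (A : Vec (Fin 2) m) (B : Vec (Fin 2) n) {M N : Matrix (zeros A) (zeros B)} →
                 extM A B M ≡ extM A B N → M ≡ N
extM-injective A B eq = map-ext-injective B (ext-injective A eq)

-- A column of `B` is 1 in the full rows and 0 elsewhere, that is, `A`. The transpose is therefore
-- again an extension, with filler `A`, and the column conditions fall under the same lemmas as the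
-- row conditions.
transpose-extM : (A : Vec (Fin 2) m) (B : Vec (Fin 2) n) (M : Matrix (zeros A) (zeros B)) →
                 transpose (extM A B M) ≡ ext B A (map (ext A 1F) (transpose M))
transpose-extM A B M = begin
  transpose (extM A B M)                              ≡⟨ transpose-ext-1s A (map (ext B 0F) M) ⟩
  map (ext A 1F) (transpose (map (ext B 0F) M))         ≡⟨ cong (map (ext A 1F)) (transpose-map-ext B M) ⟩
  map (ext A 1F) (ext B 0s (transpose M))              ≡⟨ map-ext (ext A 1F) B (transpose M) ⟩
  ext B (ext A 1F 0s) (map (ext A 1F) (transpose M))    ≡⟨ cong (λ v → ext B v (map (ext A 1F) (transpose M))) (ext-1F-0s A) ⟩
  ext B A (map (ext A 1F) (transpose M))               ∎

module _ (A : Vec (Fin 2) m) (B : Vec (Fin 2) n) (M : Matrix (zeros A) (zeros B)) where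

  extM-rows≢1s : 1 ≤ weight B → All (λ r → ext B 0F r ≢ 1s) M
  extM-rows≢1s 1≤B = All.universal (λ _ → ext≢replicate B (λ ()) 1≤B) M

  -- A nonzero column of `M` has a 1 outside `A`.
  extM-cols≢A : NoZeroCol M → All (λ c → ext A 1F c ≢ A) (transpose M)
  extM-cols≢A = All.map (λ c≢0s eq → c≢0s (ext-injective A (trans eq (sym (ext-1F-0s A)))))

Small : ℕ → ℕ → Set
Small d k = 1 ≤ k × k ≤ d

small? : ∀ d k → Dec (Small d k)
small? d k = (1 ℕ.≤? k) ×-dec (k ℕ.≤? d)

InL-extM⁺ : (A : Vec (Fin 2) m) (B : Vec (Fin 2) n) (M : Matrix (zeros A) (zeros B)) →
            Small d (weight A) → Small d (weight B) → InL d M → InL d (extM A B M)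
InL-extM⁺ {d = d} A B M (1≤A , A≤d) (1≤B , B≤d) (lone , nzr , nzc , cols , rows) =
    lonesum-ext-1s⁺ A _ (lonesum-map-ext⁺ B M lone)
  -- A full row is nonzero because a nonempty `B` guarantees a column.
  , All-ext⁺ A (λ _ → 1s≢0s) (All.map⁺ (All.map (λ r≢0s eq → r≢0s (ext-injective B (trans eq (sym (ext-replicate B))))) nzr))
  -- Every column has a 1 in the full rows, of which there is at least one.
  , subst NoZeroRow (sym (transpose-extM A B M))
      (All-ext⁺ B (λ _ → A≢0s) (All.map⁺ (All.universal (λ _ → ext≢replicate A (λ ()) 1≤A) (transpose M))))
  , subst (AtMostSameRows d) (sym (transpose-extM A B M))
      (multiplicity-ext⁺ _≟ᵛ_ _≟ᵛ_ (ext-injective A) B (extM-cols≢A A B M nzc) B≤d cols)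
  , multiplicity-ext⁺ _≟ᵛ_ _≟ᵛ_ (ext-injective B) A (extM-rows≢1s A B M 1≤B) A≤d rows
  where
  1s≢0s : 1s ≢ 0s
  1s≢0s eq = ext≢replicate B (λ ()) 1≤B (trans (ext-replicate B) eq)
  A≢0s : A ≢ 0s
  A≢0s eq = ext≢replicate A (λ ()) 1≤A (trans (ext-1F-0s A) eq)

-- `A` marks the full rows of `M`, and `B` the zero columns of the remaining rows `N`. The index
-- `suc n` supplies the column that `lonesum⇒full-row` requires, for `M` and again for `N`.
InL⇒extM : (M : Matrix m (suc n)) → InL d M → ∃₂ λ A B → ∃ λ M′ →
           M ≡ extM A B M′ × Small d (weight A) × Small d (weight B) × InL d M′
InL⇒extM {d = d} M (lone , nzr , nzc , cols , rows)
  with A , N , refl , N≢1s ← ext-split _≟ᵛ_ 1s M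
  with B , T , eqT , T≢0s ← ext-split _≟ᵛ_ 0s (transpose N)
  with refl ← transpose≡ext⇒≡map-ext B {N} eqT
  = A , B , M′ , refl , (1≤A , A≤d) , (1≤B , B≤d) , lone′ , nzr′ , nzc′ , cols′ , rows′
  where
  M′ : Matrix (zeros A) (zeros B)
  M′ = transpose T
  1≤A : 1 ≤ weight A
  1≤A with 1 ℕ.≤? weight A
  ... | yes p = p
  -- With `A` empty, all rows of `M` come from `N`, so none is full.
  ... | no ¬p = contradiction (All-ext⁺ A (λ p → contradiction p ¬p) N≢1s) (lonesum⇒full-row (ext A 1s N) lone nzc)
  1≤B : 1 ≤ weight B
  1≤B with 1 ℕ.≤? weight B
  ... | yes p = p
  -- With `B` empty, `N` has no zero column and would have a full row, but all full rows went into
  -- `A`.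
  ... | no ¬p = contradiction N≢1s (lonesum⇒full-row N (lonesum-ext-1s⁻ A N lone)
    (subst NoZeroRow (sym eqT) (All-ext⁺ B (λ p → contradiction p ¬p) T≢0s)))
  lone′ : Lonesum M′
  lone′ = lonesum-map-ext⁻ B M′ (lonesum-ext-1s⁻ A N lone)
  nzr′ : NoZeroRow M′
  nzr′ = All.map (λ er≢0s eq → er≢0s (trans (cong (ext B 0F) eq) (ext-replicate B))) (All.map⁻ (All-ext⁻ A nzr))
  nzc′ : NoZeroCol M′
  nzc′ = subst NoZeroRow (sym (transpose-involutive T)) T≢0s
  colsᴱ : AtMostSameRows d (ext B A (map (ext A 1F) (transpose M′)))
  colsᴱ = subst (AtMostSameRows d) (transpose-extM A B M′) cols
  cols′ : AtMostSameCols d M′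
  cols′ = multiplicity-ext⁻ _≟ᵛ_ _≟ᵛ_ (ext-injective A) B (extM-cols≢A A B M′ nzc′) colsᴱ
  rows′ : AtMostSameRows d M′
  rows′ = multiplicity-ext⁻ _≟ᵛ_ _≟ᵛ_ (ext-injective B) A (extM-rows≢1s A B M′ 1≤B) rows
  A≤d : weight A ≤ d
  A≤d = multiplicity-ext-filler _≟ᵛ_ _≟ᵛ_ (ext-injective B) A (extM-rows≢1s A B M′ 1≤B) 1≤A rows
  B≤d : weight B ≤ d
  B≤d = multiplicity-ext-filler _≟ᵛ_ _≟ᵛ_ (ext-injective A) B (extM-cols≢A A B M′ nzc′) 1≤B colsᴱ

-- `A` is the set of full rows, as a nonempty `B` puts a 0 into every other row.
extM-unique-rows : (A A′ : Vec (Fin 2) m) (B B′ : Vec (Fin 2) n)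
                   {M : Matrix (zeros A) (zeros B)} {M′ : Matrix (zeros A′) (zeros B′)} →
                   1 ≤ weight B → 1 ≤ weight B′ → extM A B M ≡ extM A′ B′ M′ → A ≡ A′
extM-unique-rows A A′ B B′ {M} {M′} 1≤B 1≤B′ = ext-unique A A′
  (All.map⁺ (extM-rows≢1s A B M 1≤B)) (All.map⁺ (extM-rows≢1s A′ B′ M′ 1≤B′))

-- `B` is the set of columns equal to `A`; hence the two decompositions are taken with a common `A`.
extM-unique-cols : (A : Vec (Fin 2) m) (B B′ : Vec (Fin 2) n)
                   (M : Matrix (zeros A) (zeros B)) (M′ : Matrix (zeros A) (zeros B′)) →
                   NoZeroCol M → NoZeroCol M′ → extM A B M ≡ extM A B′ M′ → B ≡ B′
extM-unique-cols A B B′ M M′ nzc nzc′ eq = ext-unique B B′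
  (All.map⁺ (extM-cols≢A A B M nzc)) (All.map⁺ (extM-cols≢A A B′ M′ nzc′))
  (trans (sym (transpose-extM A B M)) (trans (cong transpose eq) (transpose-extM A B′ M′)))

-- Listing all extensions without repetition.

concatMap-unique : (g : X → List Y) {xs : List X} → Unique xs → (∀ x → Unique (g x)) →
                   (∀ {x x′ y} → y ∈ g x → y ∈ g x′ → x ≡ x′) → Unique (concatMap g xs)
concatMap-unique g xs! g! sep = Unique.concat⁺
  (ListAll.map⁺ (ListAll.universal g! _))
  (AllPairs.map⁺ (AllPairs.map disjoint xs!))
  where
  disjoint : ∀ {x x′} → x ≢ x′ → Disjoint (g x) (g x′)
  disjoint x≢x′ (p , q) = x≢x′ (sep p q)

∈-concatMap : (g : X → List Y) (xs : List X) {x : X} {y : Y} → x ∈ xs → y ∈ g x → y ∈ concatMap g xs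
∈-concatMap g xs x∈xs y∈gx = ∈-concatMap⁺ g (lose x∈xs y∈gx)

∈-concatMap-find : (g : X → List Y) (xs : List X) {y : Y} → y ∈ concatMap g xs → ∃ λ x → x ∈ xs × y ∈ g x
∈-concatMap-find g xs p = find (∈-concatMap⁻ g {xs = xs} p)

smallSubsets : ℕ → (n : ℕ) → List (Vec (Fin 2) n)
smallSubsets d n = filter (λ A → small? d (weight A)) (allVecs (allFin 2) n)

smallSubsets-unique : ∀ d n → Unique (smallSubsets d n)
smallSubsets-unique d n = Unique.filter⁺ (λ A → small? d (weight A)) (allVecs-unique (Unique.allFin⁺ 2) n)

∈-smallSubsets⁺ : {A : Vec (Fin 2) n} → Small d (weight A) → A ∈ smallSubsets d n
∈-smallSubsets⁺ {d = d} = ∈-filter⁺ (λ A → small? d (weight A)) (∈-allVecs ∈-allFin _)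

∈-smallSubsets⁻ : {A : Vec (Fin 2) n} → A ∈ smallSubsets d n → Small d (weight A)
∈-smallSubsets⁻ {n} {d} p = proj₂ (∈-filter⁻ (λ A → small? d (weight A)) {xs = allVecs (allFin 2) n} p)

matricesL : ∀ d m n → List (Matrix m n)
matricesL d m n = filter (inL? d) (allMatrices m n)

matricesL-unique : ∀ d m n → Unique (matricesL d m n)
matricesL-unique d m n = Unique.filter⁺ (inL? d) (allMatrices-unique m n)

∈-matricesL⁺ : (M : Matrix m n) → InL d M → M ∈ matricesL d m n
∈-matricesL⁺ {d = d} M = ∈-filter⁺ (inL? d) (∈-allMatrices M)

∈-matricesL⁻ : (M : Matrix m n) → M ∈ matricesL d m n → InL d M
∈-matricesL⁻ {m} {n} {d} M p = proj₂ (∈-filter⁻ (inL? d) {xs = allMatrices m n} p)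

module _ (d : ℕ) where

  extensions : (A : Vec (Fin 2) m) (B : Vec (Fin 2) n) → List (Matrix m n)
  extensions A B = List.map (extM A B) (matricesL d (zeros A) (zeros B))

  rowExtensions : ∀ n → Vec (Fin 2) m → List (Matrix m n)
  rowExtensions n A = concatMap (extensions A) (smallSubsets d n)

  allExtensions : ∀ m n → List (Matrix m n)
  allExtensions m n = concatMap (rowExtensions n) (smallSubsets d m)

  ∈-extensions⁻ : (A : Vec (Fin 2) m) (B : Vec (Fin 2) n) {N : Matrix m n} →
                  N ∈ extensions A B → ∃ λ M → N ≡ extM A B M × InL d M
  ∈-extensions⁻ A B p with M , M∈ , eq ← ∈-map⁻ (extM A B) p = M , eq , ∈-matricesL⁻ M M∈

  ∈-rowExtensions⁻ : (A : Vec (Fin 2) m) {N : Matrix m n} → N ∈ rowExtensions n A →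
                     ∃₂ λ B M → N ≡ extM A B M × Small d (weight B) × InL d M
  ∈-rowExtensions⁻ {n = n} A p
    with B , B∈ , N∈ ← ∈-concatMap-find (extensions A) (smallSubsets d n) p
    with M , eq , M∈ ← ∈-extensions⁻ A B N∈
    = B , M , eq , ∈-smallSubsets⁻ B∈ , M∈

  allExtensions-unique : ∀ m n → Unique (allExtensions m n)
  allExtensions-unique m n = concatMap-unique (rowExtensions n) (smallSubsets-unique d m)
    (λ A → concatMap-unique (extensions A) (smallSubsets-unique d n)
      (λ B → Unique.map⁺ (extM-injective A B) (matricesL-unique d _ _))
      (λ {B} {B′} p q → sameCols A B B′ (∈-extensions⁻ A B p) (∈-extensions⁻ A B′ q)))
    (λ {A} {A′} p q → sameRows A A′ (∈-rowExtensions⁻ A p) (∈-rowExtensions⁻ A′ q))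
    where
    sameCols : ∀ A (B B′ : Vec (Fin 2) n) {N : Matrix m n} → (∃ λ M → N ≡ extM A B M × InL d M) →
               (∃ λ M → N ≡ extM A B′ M × InL d M) → B ≡ B′
    sameCols A B B′ (M , eq , _ , _ , nzc , _) (M′ , eq′ , _ , _ , nzc′ , _) =
      extM-unique-cols A B B′ M M′ nzc nzc′ (trans (sym eq) eq′)
    sameRows : ∀ (A A′ : Vec (Fin 2) m) {N : Matrix m n} →
               (∃₂ λ B M → N ≡ extM A B M × Small d (weight B) × InL d M) →
               (∃₂ λ B M → N ≡ extM A′ B M × Small d (weight B) × InL d M) → A ≡ A′
    sameRows A A′ (B , _ , eq , (1≤B , _) , _) (B′ , _ , eq′ , (1≤B′ , _) , _) =
      extM-unique-rows A A′ B B′ 1≤B 1≤B′ (trans (sym eq) eq′)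

  ∈-allExtensions⁺ : (N : Matrix m n) →
                     (∃₂ λ A B → ∃ λ M → N ≡ extM A B M × Small d (weight A) × Small d (weight B) × InL d M) →
                     N ∈ allExtensions m n
  ∈-allExtensions⁺ {m} {n} _ (A , B , M , refl , A-small , B-small , M∈) =
    ∈-concatMap (rowExtensions n) (smallSubsets d m) (∈-smallSubsets⁺ A-small)
      (∈-concatMap (extensions A) (smallSubsets d n) (∈-smallSubsets⁺ B-small)
        (∈-map⁺ (extM A B) (∈-matricesL⁺ M M∈)))

  ∈-allExtensions⁻ : (N : Matrix m n) → N ∈ allExtensions m n → InL d N
  ∈-allExtensions⁻ {m} {n} N p = go (∈-concatMap-find (rowExtensions n) (smallSubsets d m) p)
    where
    go′ : ∀ A → A ∈ smallSubsets d m →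
          (∃₂ λ B M → N ≡ extM A B M × Small d (weight B) × InL d M) → InL d N
    go′ A A∈ (B , M , eq , B-small , M∈) = subst (InL d) (sym eq) (InL-extM⁺ A B M (∈-smallSubsets⁻ A∈) B-small M∈)
    go : (∃ λ A → A ∈ smallSubsets d m × N ∈ rowExtensions n A) → InL d N
    go (A , A∈ , N∈) = go′ A A∈ (∈-rowExtensions⁻ A N∈)

  InL⇒∈-allExtensions : ¬ (m ≡ 0 × n ≡ 0) → (N : Matrix m n) → InL d N → N ∈ allExtensions m n
  InL⇒∈-allExtensions {zero}  {zero}  nonempty _ _ = contradiction (refl , refl) nonempty
  -- A row of length 0 counts as a zero row.
  InL⇒∈-allExtensions {suc m} {zero}  _ ([] ∷ _) (_ , nz ∷ _ , _) = contradiction refl nz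
  -- This includes `m = 0`, where `lonesum⇒full-row` refutes the hypothesis.
  InL⇒∈-allExtensions {m}     {suc n} _ N N∈ = ∈-allExtensions⁺ N (InL⇒extM N N∈)

  -- Both lists are free of repetitions and have the same members, so they are permutations of each
  -- other.
  countL≡length-allExtensions : ∀ m n → ¬ (m ≡ 0 × n ≡ 0) → countL d m n ≡ length (allExtensions m n)
  countL≡length-allExtensions m n nonempty = ↭-length (∼bag⇒↭
    (unique∧set⇒bag (matricesL-unique d m n) (allExtensions-unique m n)
      (λ {M} → mk⇔ (λ p → InL⇒∈-allExtensions nonempty M (∈-matricesL⁻ M p)) (λ p → ∈-matricesL⁺ M (∈-allExtensions⁻ M p)))))

-- Natural numbers and inverse factorials in the rationals.

fromℚᵘ-homo-+ : ∀ p q → fromℚᵘ (p ℚᵘ.+ q) ≡ fromℚᵘ p + fromℚᵘ q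
fromℚᵘ-homo-+ p q = toℚᵘ-injective (ℚᵘ.≃-trans (toℚᵘ-fromℚᵘ (p ℚᵘ.+ q)) (ℚᵘ.≃-sym
  (ℚᵘ.≃-trans (toℚᵘ-homo-+ (fromℚᵘ p) (fromℚᵘ q)) (ℚᵘ.+-cong (toℚᵘ-fromℚᵘ p) (toℚᵘ-fromℚᵘ q)))))

fromℚᵘ-homo-* : ∀ p q → fromℚᵘ (p ℚᵘ.* q) ≡ fromℚᵘ p * fromℚᵘ q
fromℚᵘ-homo-* p q = toℚᵘ-injective (ℚᵘ.≃-trans (toℚᵘ-fromℚᵘ (p ℚᵘ.* q)) (ℚᵘ.≃-sym
  (ℚᵘ.≃-trans (toℚᵘ-homo-* (fromℚᵘ p) (fromℚᵘ q)) (ℚᵘ.*-cong (toℚᵘ-fromℚᵘ p) (toℚᵘ-fromℚᵘ q)))))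

ι : ℕ → ℚ
ι n = ℤ.+ n / 1

ι-+ : ∀ a b → ι (a ℕ.+ b) ≡ ι a + ι b
ι-+ a b = trans (fromℚᵘ-cong {mkℚᵘ (ℤ.+ (a ℕ.+ b)) 0} {mkℚᵘ (ℤ.+ a) 0 ℚᵘ.+ mkℚᵘ (ℤ.+ b) 0} (*≡* (cong (ℤ._* ℤ.+ 1) (sym (cong₂ ℤ._+_ (ℤ.*-identityʳ (ℤ.+ a)) (ℤ.*-identityʳ (ℤ.+ b)))))))
                (fromℚᵘ-homo-+ (mkℚᵘ (ℤ.+ a) 0) (mkℚᵘ (ℤ.+ b) 0))

ι-*-1/ : ∀ a k .{{_ : NonZero k}} .{{_ : NonZero (suc a ℕ.* k)}} →
         ι (suc a) * (ℤ.+ 1 / (suc a ℕ.* k)) ≡ ℤ.+ 1 / k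
ι-*-1/ a (suc k) = sym (trans
  -- `mkℚᵘ` takes the denominator minus one, and `k + a * suc k` is the predecessor of
  -- `suc a * suc k`.
  (fromℚᵘ-cong {mkℚᵘ (ℤ.+ 1) k} {mkℚᵘ (ℤ.+ suc a) 0 ℚᵘ.* mkℚᵘ (ℤ.+ 1) (k ℕ.+ a ℕ.* suc k)}
    (*≡* (cong ℤ.+_ (begin
      1 ℕ.* (1 ℕ.* (suc a ℕ.* suc k)) ≡⟨ ℕ.*-identityˡ _ ⟩
      1 ℕ.* (suc a ℕ.* suc k)         ≡⟨ ℕ.*-identityˡ _ ⟩
      suc a ℕ.* suc k                 ≡⟨ cong (ℕ._* suc k) (ℕ.*-identityʳ (suc a)) ⟨
      suc a ℕ.* 1 ℕ.* suc k           ∎))))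
  (fromℚᵘ-homo-* (mkℚᵘ (ℤ.+ suc a) 0) (mkℚᵘ (ℤ.+ 1) (k ℕ.+ a ℕ.* suc k))))

ι-*-1/! : ∀ n → ι (suc n) * 1/! suc n ≡ 1/! n
ι-*-1/! n = ι-*-1/ n (n !) {{n ℕ.!≢0}} {{suc n ℕ.!≢0}}

ι-suc-cancel : ∀ n {x y} → ι (suc n) * x ≡ ι (suc n) * y → x ≡ y
ι-suc-cancel n {x} {y} eq = begin
  x                       ≡⟨ unit x ⟩
  r * (ι (suc n) * x)     ≡⟨ cong (r *_) eq ⟩
  r * (ι (suc n) * y)     ≡⟨ unit y ⟨
  y                       ∎
  where
  r : ℚ
  -- The factor 1 gives the denominator the shape of `ι-*-1/` with `k = 1`.
  r = ℤ.+ 1 / (suc n ℕ.* 1)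
  unit : ∀ z → z ≡ r * (ι (suc n) * z)
  unit z = begin
    z                     ≡⟨ *-identityˡ z ⟨
    1ℚ * z                ≡⟨ cong (_* z) (ι-*-1/ n 1) ⟨
    ι (suc n) * r * z     ≡⟨ cong (_* z) (*-comm (ι (suc n)) r) ⟩
    r * ι (suc n) * z     ≡⟨ *-assoc r (ι (suc n)) z ⟩
    r * (ι (suc n) * z)   ∎

-- Antidiagonal sums.

-- D m k = ∑_{a+b=m} k a b
D : ℕ → (ℕ → ℕ → ℚ) → ℚ
D zero    k = k 0 0
D (suc m) k = k 0 (suc m) + D m (λ a b → k (suc a) b)

sum≡D : ∀ m (k : ℕ → ℕ → ℚ) → ℚSum.sum {suc m} (λ a → k (toℕ a) (m ∸ toℕ a)) ≡ D m k
sum≡D zero    k = +-identityʳ (k 0 0)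
sum≡D (suc m) k = cong (k 0 (suc m) +_) (sum≡D m (λ a b → k (suc a) b))

D-cong : ∀ m {k l : ℕ → ℕ → ℚ} → (∀ a b → k a b ≡ l a b) → D m k ≡ D m l
D-cong zero    eq = eq 0 0
D-cong (suc m) eq = cong₂ _+_ (eq 0 (suc m)) (D-cong m (λ a b → eq (suc a) b))

D-+ : ∀ m (k l : ℕ → ℕ → ℚ) → D m (λ a b → k a b + l a b) ≡ D m k + D m l
D-+ zero    k l = refl
D-+ (suc m) k l = trans
  (cong (k 0 (suc m) + l 0 (suc m) +_) (D-+ m (λ a b → k (suc a) b) (λ a b → l (suc a) b)))
  (solve 4 (λ a b c d → (a :+ b) :+ (c :+ d) := (a :+ c) :+ (b :+ d)) refl
    (k 0 (suc m)) (l 0 (suc m)) (D m (λ a b → k (suc a) b)) (D m (λ a b → l (suc a) b)))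

D-minus : ∀ m (k l : ℕ → ℕ → ℚ) → D m (λ a b → k a b - l a b) ≡ D m k - D m l
D-minus zero    k l = refl
D-minus (suc m) k l = trans
  (cong (k 0 (suc m) - l 0 (suc m) +_) (D-minus m (λ a b → k (suc a) b) (λ a b → l (suc a) b)))
  (solve 4 (λ a b c d → (a :- b) :+ (c :- d) := (a :+ c) :- (b :+ d)) refl
    (k 0 (suc m)) (l 0 (suc m)) (D m (λ a b → k (suc a) b)) (D m (λ a b → l (suc a) b)))

-- `a + b` is constant on the antidiagonal. The induction varies `f`, since the shift in `a`
-- replaces it by its composite with `suc`.
D-graded : ∀ m (f : ℕ → ℚ) (k : ℕ → ℕ → ℚ) → D m (λ a b → f (a ℕ.+ b) * k a b) ≡ f m * D m k
D-graded zero    f k = refl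
D-graded (suc m) f k = trans
  (cong (f (suc m) * k 0 (suc m) +_) (D-graded m (λ i → f (suc i)) (λ a b → k (suc a) b)))
  (sym (*-distribˡ-+ (f (suc m)) (k 0 (suc m)) (D m (λ a b → k (suc a) b))))

D-*ˡ : ∀ m q (k : ℕ → ℕ → ℚ) → D m (λ a b → q * k a b) ≡ q * D m k
D-*ˡ m q = D-graded m (λ _ → q)

D-last : ∀ m (k : ℕ → ℕ → ℚ) → D (suc m) k ≡ D m (λ a b → k a (suc b)) + k (suc m) 0
D-last zero    k = refl
D-last (suc m) k = trans
  (cong (k 0 (suc (suc m)) +_) (D-last m (λ a b → k (suc a) b)))
  (sym (+-assoc (k 0 (suc (suc m))) (D m (λ a b → k (suc a) (suc b))) (k (suc (suc m)) 0)))

D-zero : ∀ m {k : ℕ → ℕ → ℚ} → (∀ a b → k a b ≡ 0ℚ) → D m k ≡ 0ℚ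
D-zero zero    eq = eq 0 0
D-zero (suc m) eq = cong₂ _+_ (eq 0 (suc m)) (D-zero m (λ a b → eq (suc a) b))

D-only-first : ∀ m {k : ℕ → ℕ → ℚ} → (∀ a b → k (suc a) b ≡ 0ℚ) → D m k ≡ k 0 m
D-only-first zero    eq = refl
D-only-first (suc m) {k} eq = trans (cong (k 0 (suc m) +_) (D-zero m eq)) (+-identityʳ (k 0 (suc m)))

D-only-last : ∀ m {k : ℕ → ℕ → ℚ} → (∀ a b → k a (suc b) ≡ 0ℚ) → D m k ≡ k m 0
D-only-last zero    eq = refl
D-only-last (suc m) {k} eq = trans (D-last m k) (trans (cong (_+ k (suc m) 0) (D-zero m eq)) (+-identityˡ (k (suc m) 0)))

-- The product rule for d/dx on coefficients.
D-derivative : ∀ m (k : ℕ → ℕ → ℚ) → ι (suc m) * D (suc m) k ≡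
               D m (λ a b → ι (suc a) * k (suc a) b) + D m (λ a b → ι (suc b) * k a (suc b))
D-derivative m k = begin
  ι (suc m) * D (suc m) k
    ≡⟨ D-graded (suc m) ι k ⟨
  D (suc m) (λ a b → ι (a ℕ.+ b) * k a b)
    ≡⟨ D-cong (suc m) (λ a b → trans (cong (_* k a b) (ι-+ a b)) (*-distribʳ-+ (k a b) (ι a) (ι b))) ⟩
  D (suc m) (λ a b → ι a * k a b + ι b * k a b)
    ≡⟨ D-+ (suc m) (λ a b → ι a * k a b) (λ a b → ι b * k a b) ⟩
  D (suc m) (λ a b → ι a * k a b) + D (suc m) (λ a b → ι b * k a b)
    -- The factor `ι 0` removes the term `a = 0` from the first sum and the term `b = 0` from the
    -- second.
    ≡⟨ cong₂ _+_ (trans (cong (_+ K₁) (*-zeroˡ (k 0 (suc m)))) (+-identityˡ K₁))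
         (trans (D-last m (λ a b → ι b * k a b)) (trans (cong (K₂ +_) (*-zeroˡ (k (suc m) 0))) (+-identityʳ K₂))) ⟩
  K₁ + K₂ ∎
  where
  K₁ K₂ : ℚ
  K₁ = D m (λ a b → ι (suc a) * k (suc a) b)
  K₂ = D m (λ a b → ι (suc b) * k a (suc b))

-- Sums over lists and over all subsets.

∑ : List X → (X → ℚ) → ℚ
∑ []       h = 0ℚ
∑ (x ∷ xs) h = h x + ∑ xs h

∑-cong : (xs : List X) {h h′ : X → ℚ} → (∀ x → h x ≡ h′ x) → ∑ xs h ≡ ∑ xs h′
∑-cong []       eq = refl
∑-cong (x ∷ xs) eq = cong₂ _+_ (eq x) (∑-cong xs eq)

∑-*ˡ : (xs : List X) (q : ℚ) (h : X → ℚ) → ∑ xs (λ x → q * h x) ≡ q * ∑ xs h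
∑-*ˡ []       q h = sym (*-zeroʳ q)
∑-*ˡ (x ∷ xs) q h = trans (cong (q * h x +_) (∑-*ˡ xs q h)) (sym (*-distribˡ-+ q (h x) (∑ xs h)))

∑-++ : (xs ys : List X) (h : X → ℚ) → ∑ (xs ++ ys) h ≡ ∑ xs h + ∑ ys h
∑-++ []       ys h = sym (+-identityˡ _)
∑-++ (x ∷ xs) ys h = trans (cong (h x +_) (∑-++ xs ys h)) (sym (+-assoc (h x) _ _))

∑-map : (f : X → Y) (xs : List X) (h : Y → ℚ) → ∑ (List.map f xs) h ≡ ∑ xs (λ x → h (f x))
∑-map f []       h = refl
∑-map f (x ∷ xs) h = cong (h (f x) +_) (∑-map f xs h)

-- The Iverson bracket; it turns a filtered sum into a weighted sum over everything.
[_]ℚ : Bool → ℚ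
[ b ]ℚ = if b then 1ℚ else 0ℚ

∑-filter : {P : X → Set} (P? : Decidable P) (xs : List X) (h : X → ℚ) →
           ∑ (filter P? xs) h ≡ ∑ xs (λ x → [ does (P? x) ]ℚ * h x)
∑-filter P? []       h = refl
∑-filter P? (x ∷ xs) h with does (P? x)
... | true  = cong₂ _+_ (sym (*-identityˡ (h x))) (∑-filter P? xs h)
... | false = trans (∑-filter P? xs h) (trans (sym (+-identityˡ _)) (cong (_+ _) (sym (*-zeroˡ (h x)))))

ι-length-concatMap : (g : X → List Y) (xs : List X) →
                     ι (length (concatMap g xs)) ≡ ∑ xs (λ x → ι (length (g x)))
ι-length-concatMap g []       = refl
ι-length-concatMap g (x ∷ xs) = begin
  ι (length (g x ++ concatMap g xs))                 ≡⟨ cong ι (length-++ (g x)) ⟩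
  ι (length (g x) ℕ.+ length (concatMap g xs))       ≡⟨ ι-+ (length (g x)) _ ⟩
  ι (length (g x)) + ι (length (concatMap g xs))     ≡⟨ cong (ι (length (g x)) +_) (ι-length-concatMap g xs) ⟩
  ι (length (g x)) + ∑ xs (λ x → ι (length (g x)))   ∎

subsets : ∀ n → List (Vec (Fin 2) n)
subsets = allVecs (allFin 2)

∑-subsets-suc : ∀ n (h : ℕ → ℕ → ℚ) → ∑ (subsets (suc n)) (λ A → h (weight A) (zeros A)) ≡
                ∑ (subsets n) (λ A → h (weight A) (suc (zeros A))) + ∑ (subsets n) (λ A → h (suc (weight A)) (zeros A))
∑-subsets-suc n h = begin
  -- The subsets with first entry 0, those with first entry 1, and the empty end of
  -- `cartesianProductWith`.
  ∑ (zs ++ os ++ []) H   ≡⟨ ∑-++ zs (os ++ []) H ⟩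
  ∑ zs H + ∑ (os ++ []) H ≡⟨ cong₂ _+_ (∑-map (0F Vec.∷_) (subsets n) H)
                              (trans (∑-++ os [] H) (trans (+-identityʳ _) (∑-map (1F Vec.∷_) (subsets n) H))) ⟩
  ∑ (subsets n) (λ A → h (weight A) (suc (zeros A))) + ∑ (subsets n) (λ A → h (suc (weight A)) (zeros A)) ∎
  where
  H : Vec (Fin 2) (suc n) → ℚ
  H A = h (weight A) (zeros A)
  zs os : List (Vec (Fin 2) (suc n))
  zs = List.map (0F Vec.∷_) (subsets n)
  os = List.map (1F Vec.∷_) (subsets n)

-- There are n!/(a! b!) subsets with `a` zeros and `b` ones. The induction avoids counting them:
-- after multiplication by `suc n`, the left side splits by the first entry of the subset, and the
-- right side splits in the same way by the product rule.
∑-subsets : ∀ n (h : ℕ → ℕ → ℚ) → 1/! n * ∑ (subsets n) (λ A → h (weight A) (zeros A)) ≡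
            D n (λ a b → 1/! a * 1/! b * h b a)
∑-subsets zero    h = trans (*-identityˡ _) (trans (+-identityʳ (h 0 0)) (sym (*-identityˡ (h 0 0))))
∑-subsets (suc n) h = ι-suc-cancel n (begin
  ι (suc n) * (1/! suc n * ∑ (subsets (suc n)) (λ A → h (weight A) (zeros A)))
    ≡⟨ *-assoc (ι (suc n)) (1/! suc n) _ ⟨
  ι (suc n) * 1/! suc n * ∑ (subsets (suc n)) (λ A → h (weight A) (zeros A))
    ≡⟨ cong₂ _*_ (ι-*-1/! n) (∑-subsets-suc n h) ⟩
  1/! n * (∑ (subsets n) (λ A → h (weight A) (suc (zeros A))) + ∑ (subsets n) (λ A → h (suc (weight A)) (zeros A)))
    ≡⟨ *-distribˡ-+ (1/! n) _ _ ⟩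
  1/! n * ∑ (subsets n) (λ A → h (weight A) (suc (zeros A))) + 1/! n * ∑ (subsets n) (λ A → h (suc (weight A)) (zeros A))
    ≡⟨ cong₂ _+_ (∑-subsets n (λ w z → h w (suc z))) (∑-subsets n (λ w z → h (suc w) z)) ⟩
  D n (λ a b → 1/! a * 1/! b * h b (suc a)) + D n (λ a b → 1/! a * 1/! b * h (suc b) a)
    ≡⟨ cong₂ _+_ (D-cong n (λ a b → left a (1/! b) (h b (suc a)))) (D-cong n (λ a b → right (1/! a) b (h (suc b) a))) ⟩
  D n (λ a b → ι (suc a) * (1/! suc a * 1/! b * h b (suc a))) + D n (λ a b → ι (suc b) * (1/! a * 1/! suc b * h (suc b) a))
    ≡⟨ D-derivative n (λ a b → 1/! a * 1/! b * h b a) ⟨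
  ι (suc n) * D (suc n) (λ a b → 1/! a * 1/! b * h b a) ∎)
  where
  left : ∀ a x y → 1/! a * x * y ≡ ι (suc a) * (1/! suc a * x * y)
  left a x y = trans (cong (λ z → z * x * y) (sym (ι-*-1/! a)))
    (solve 4 (λ i f x y → i :* f :* x :* y := i :* (f :* x :* y)) refl (ι (suc a)) (1/! suc a) x y)
  right : ∀ x b y → x * 1/! b * y ≡ ι (suc b) * (x * 1/! suc b * y)
  right x b y = trans (cong (λ z → x * z * y) (sym (ι-*-1/! b)))
    (solve 4 (λ i f x y → x :* (i :* f) :* y := i :* (x :* f :* y)) refl (ι (suc b)) (1/! suc b) x y)

-- The recurrence for the coefficients.

module _ (d : ℕ) where

  χ : ℕ → ℚ
  χ k = [ does (small? d k) ]ℚ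

  ∑-smallSubsets : ∀ n (h : Vec (Fin 2) n → ℚ) →
                   ∑ (smallSubsets d n) h ≡ ∑ (subsets n) (λ A → χ (weight A) * h A)
  ∑-smallSubsets n h = ∑-filter (λ A → small? d (weight A)) (subsets n) h

  countL-recurrence : ∀ m n → ¬ (m ≡ 0 × n ≡ 0) → ι (countL d m n) ≡
    ∑ (subsets m) (λ A → χ (weight A) * ∑ (subsets n) (λ B → χ (weight B) * ι (countL d (zeros A) (zeros B))))
  countL-recurrence m n nonempty = begin
    ι (countL d m n)
      ≡⟨ cong ι (countL≡length-allExtensions d m n nonempty) ⟩
    ι (length (allExtensions d m n))
      ≡⟨ ι-length-concatMap (rowExtensions d n) (smallSubsets d m) ⟩
    ∑ (smallSubsets d m) (λ A → ι (length (rowExtensions d n A)))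
      ≡⟨ ∑-smallSubsets m (λ A → ι (length (rowExtensions d n A))) ⟩
    ∑ (subsets m) (λ A → χ (weight A) * ι (length (rowExtensions d n A)))
      ≡⟨ ∑-cong (subsets m) (λ A → cong (χ (weight A) *_) (inner A)) ⟩
    ∑ (subsets m) (λ A → χ (weight A) * ∑ (subsets n) (λ B → χ (weight B) * ι (countL d (zeros A) (zeros B)))) ∎
    where
    inner : ∀ A → ι (length (rowExtensions d n A)) ≡
                  ∑ (subsets n) (λ B → χ (weight B) * ι (countL d (zeros A) (zeros B)))
    inner A = begin
      ι (length (rowExtensions d n A))
        ≡⟨ ι-length-concatMap (extensions d A) (smallSubsets d n) ⟩
      ∑ (smallSubsets d n) (λ B → ι (length (extensions d A B)))
        ≡⟨ ∑-cong (smallSubsets d n) (λ B → cong ι (length-map (extM A B) (matricesL d (zeros A) (zeros B)))) ⟩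
      ∑ (smallSubsets d n) (λ B → ι (countL d (zeros A) (zeros B)))
        ≡⟨ ∑-smallSubsets n (λ B → ι (countL d (zeros A) (zeros B))) ⟩
      ∑ (subsets n) (λ B → χ (weight B) * ι (countL d (zeros A) (zeros B))) ∎

  -- The coefficients of E_d(z) − 1.
  E⁺ : ℕ → ℚ
  E⁺ k = χ k * 1/! k

  -- `∑-subsets` is used once in each dimension. Indicator and inverse factorial of a deleted size
  -- combine to `E⁺`; the inverse factorials of the remaining sizes go with `w`.
  ∑∑-subsets : ∀ m n (w : ℕ → ℕ → ℚ) →
    ∑ (subsets m) (λ A → χ (weight A) * ∑ (subsets n) (λ B → χ (weight B) * w (zeros A) (zeros B))) * (1/! m * 1/! n) ≡
    D m (λ a a′ → D n (λ b b′ → w a b * (1/! a * 1/! b) * (E⁺ a′ * E⁺ b′)))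
  ∑∑-subsets m n w = begin
    ∑ (subsets m) (λ A → χ (weight A) * S (zeros A)) * (1/! m * 1/! n)
      ≡⟨ solve 3 (λ s x y → s :* (x :* y) := x :* (y :* s)) refl
           (∑ (subsets m) (λ A → χ (weight A) * S (zeros A))) (1/! m) (1/! n) ⟩
    1/! m * (1/! n * ∑ (subsets m) (λ A → χ (weight A) * S (zeros A)))
      ≡⟨ cong (1/! m *_) (∑-*ˡ (subsets m) (1/! n) (λ A → χ (weight A) * S (zeros A))) ⟨
    1/! m * ∑ (subsets m) (λ A → 1/! n * (χ (weight A) * S (zeros A)))
      ≡⟨ ∑-subsets m (λ k z → 1/! n * (χ k * S z)) ⟩
    D m (λ a a′ → 1/! a * 1/! a′ * (1/! n * (χ a′ * S a)))
      ≡⟨ D-cong m (λ a a′ → begin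
           1/! a * 1/! a′ * (1/! n * (χ a′ * S a))
             ≡⟨ solve 5 (λ x y z c s → x :* y :* (z :* (c :* s)) := (x :* (c :* y)) :* (z :* s)) refl
                  (1/! a) (1/! a′) (1/! n) (χ a′) (S a) ⟩
           1/! a * E⁺ a′ * (1/! n * S a)
             ≡⟨ cong (1/! a * E⁺ a′ *_) (∑-subsets n (λ k z → χ k * w a z)) ⟩
           1/! a * E⁺ a′ * D n (λ b b′ → 1/! b * 1/! b′ * (χ b′ * w a b))
             ≡⟨ D-*ˡ n (1/! a * E⁺ a′) (λ b b′ → 1/! b * 1/! b′ * (χ b′ * w a b)) ⟨
           D n (λ b b′ → 1/! a * E⁺ a′ * (1/! b * 1/! b′ * (χ b′ * w a b)))
             ≡⟨ D-cong n (λ b b′ → solve 6 (λ x e y z c v → x :* e :* (y :* z :* (c :* v)) := v :* (x :* y) :* (e :* (c :* z)))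
                  refl (1/! a) (E⁺ a′) (1/! b) (1/! b′) (χ b′) (w a b)) ⟩
           D n (λ b b′ → w a b * (1/! a * 1/! b) * (E⁺ a′ * E⁺ b′)) ∎) ⟩
    D m (λ a a′ → D n (λ b b′ → w a b * (1/! a * 1/! b) * (E⁺ a′ * E⁺ b′))) ∎
    where
    S : ℕ → ℚ
    S z = ∑ (subsets n) (λ B → χ (weight B) * w z (zeros B))

  L-recurrence : ∀ m n → ¬ (m ≡ 0 × n ≡ 0) →
                 L d m n ≡ D m (λ a a′ → D n (λ b b′ → L d a b * (E⁺ a′ * E⁺ b′)))
  L-recurrence m n nonempty = trans (cong (_* (1/! m * 1/! n)) (countL-recurrence m n nonempty))
                                    (∑∑-subsets m n (λ a b → ι (countL d a b)))

  E-suc : ∀ k → E d (suc k) ≡ E⁺ (suc k)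
  -- `does (small? d (suc k))` reduces to this same test, so one case split settles both sides.
  E-suc k with suc k ≤ᵇ d
  ... | true  = sym (*-identityˡ (1/! suc k))
  ... | false = sym (*-zeroˡ (1/! suc k))

-- The identity of power series.

⊗≡D : ∀ (f g : Series) m n → (f ⊗ g) m n ≡ D m (λ a a′ → D n (λ b b′ → f a b * g a′ b′))
⊗≡D f g m n = trans (sum≡D m (λ a a′ → ℚSum.sum {suc n} (λ b → f a (toℕ b) * g a′ (n ∸ toℕ b))))
                    (D-cong m (λ a a′ → sum≡D n (λ b b′ → f a b * g a′ b′)))

inX⊗inY : ∀ (f g : ℕ → ℚ) m n → (inX f ⊗ inY g) m n ≡ f m * g n
inX⊗inY f g m n = begin
  (inX f ⊗ inY g) m n                                       ≡⟨ ⊗≡D (inX f) (inY g) m n ⟩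
  D m (λ a a′ → D n (λ b b′ → inX f a b * inY g a′ b′))     ≡⟨ D-only-last m (λ a a′ → D-zero n (λ b b′ → *-zeroʳ (inX f a b))) ⟩
  D n (λ b b′ → inX f m b * inY g 0 b′)                     ≡⟨ D-only-first n (λ b b′ → *-zeroˡ (g b′)) ⟩
  f m * g n                                                 ∎

⊗-identityʳ : ∀ (f : Series) m n → D m (λ a a′ → D n (λ b b′ → f a b * 𝟏 a′ b′)) ≡ f m n
⊗-identityʳ f m n = begin
  D m (λ a a′ → D n (λ b b′ → f a b * 𝟏 a′ b′))  ≡⟨ D-only-last m (λ a a′ → D-zero n (λ b b′ → *-zeroʳ (f a b))) ⟩
  D n (λ b b′ → f m b * 𝟏 0 b′)                  ≡⟨ D-only-last n (λ b b′ → *-zeroʳ (f m b)) ⟩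
  f m n * 1ℚ                                     ≡⟨ *-identityʳ (f m n) ⟩
  f m n                                          ∎

denominator : ∀ d m n → (inX (E d) ⊕ inY (E d) ⊖ inX (E d) ⊗ inY (E d)) m n ≡ 𝟏 m n - E⁺ d m * E⁺ d n
denominator d m n = trans (cong (λ z → inX (E d) m n + inY (E d) m n - z) (inX⊗inY (E d) (E d) m n)) (cases m n)
  where
  cases : ∀ m n → inX (E d) m n + inY (E d) m n - E d m * E d n ≡ 𝟏 m n - E⁺ d m * E⁺ d n
  -- For every `d`, `E d 0` computes to 1 and `E⁺ d 0` to 0.
  cases zero    zero    = refl
  cases zero    (suc n) = solve 2 (λ e e⁺ → con 0ℚ :+ e :- con 1ℚ :* e := con 0ℚ :- con 0ℚ :* e⁺) refl
                            (E d (suc n)) (E⁺ d (suc n))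
  cases (suc m) zero    = solve 2 (λ e e⁺ → e :+ con 0ℚ :- e :* con 1ℚ := con 0ℚ :- e⁺ :* con 0ℚ) refl
                            (E d (suc m)) (E⁺ d (suc m))
  cases (suc m) (suc n) = cong₂ (λ x y → 0ℚ - x * y) (E-suc d m) (E-suc d n)

theorem3 : (d : ℕ) → 1 ≤ d →
    L d ≋1/ (inX (E d) ⊕ inY (E d) ⊖ inX (E d) ⊗ inY (E d))
theorem3 d _ m n = begin
  (L d ⊗ G) m n
    ≡⟨ ⊗≡D (L d) G m n ⟩
  D m (λ a a′ → D n (λ b b′ → L d a b * G a′ b′))
    ≡⟨ D-cong m (λ a a′ → trans (D-cong n (λ b b′ → split (L d a b) a′ b′)) (D-minus n _ _)) ⟩
  D m (λ a a′ → D n (λ b b′ → L d a b * 𝟏 a′ b′) - D n (λ b b′ → L d a b * (E⁺ d a′ * E⁺ d b′)))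
    ≡⟨ D-minus m _ _ ⟩
  D m (λ a a′ → D n (λ b b′ → L d a b * 𝟏 a′ b′)) - R m n
    ≡⟨ cong (_- R m n) (⊗-identityʳ (L d) m n) ⟩
  L d m n - R m n
    ≡⟨ final m n ⟩
  𝟏 m n ∎
  where
  G : Series
  G = inX (E d) ⊕ inY (E d) ⊖ inX (E d) ⊗ inY (E d)
  R : Series
  R m n = D m (λ a a′ → D n (λ b b′ → L d a b * (E⁺ d a′ * E⁺ d b′)))
  split : ∀ q a b → q * G a b ≡ q * 𝟏 a b - q * (E⁺ d a * E⁺ d b)
  split q a b = trans (cong (q *_) (denominator d a b))
    (solve 3 (λ q x y → q :* (x :- y) := q :* x :- q :* y) refl q (𝟏 a b) (E⁺ d a * E⁺ d b))
  cancel : ∀ m n → ¬ (m ≡ 0 × n ≡ 0) → L d m n - R m n ≡ 0ℚ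
  cancel m n nonempty = trans (cong (_- R m n) (L-recurrence d m n nonempty)) (+-inverseʳ (R m n))
  final : ∀ m n → L d m n - R m n ≡ 𝟏 m n
  -- The empty matrix contributes 1 to `L d 0 0`, and `R 0 0` vanishes because `E⁺ d 0` is 0.
  final zero    zero    = refl
  final zero    (suc n) = cancel zero (suc n) (λ ())
  final (suc m) n       = cancel (suc m) n (λ ())
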